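{- For online one-dimensional bin packing with known optimal cost (K-O), every online algorithm has asymptotic competitive ratio at least $\frac{87}{62}\approx 1.4032258$.
   Context: In one-dimensional bin packing, the input is a sequence of items with rational sizes in $(0,1]$, and the items must be partitioned into bins so that the total size of the items in each bin is at most $1$; the cost is the number of bins used. In the online version, items arrive one by one and each item must be irrevocably assigned to a bin before the next item is revealed. In the K-O (known optimal cost) variant, the online algorithm is told in advance the value $OPT(I)$, the minimum number of bins needed to pack the whole input $I$ (the items themselves are still revealed online). Online algorithms are deterministic. For an algorithm $A$, let $A(I)$ be its cost on input $I$, let $c(Q)=\max\{A(I): OPT(I)=Q\}$, and define the asymptotic competitive ratio of $A$ as $R_A=\limsup_{Q\to\infty} c(Q)/Q$. -}

module Defs where

open import Data.Nat as ℕ using (ℕ; zero; suc)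
open import Data.Integer using (+_)
open import Data.Fin using (Fin)
open import Data.Fin.Properties using () renaming (_≟_ to _≟ᶠ_)
open import Data.Rational using (ℚ; 0ℚ; 1ℚ; _+_; _≤_; _<_; _/_)
open import Data.List using (List; []; _∷_; length; _++_)
open import Data.List.Relation.Unary.All using (All)
open import Data.Product using (Σ; _×_)
open import Data.Bool using (if_then_else_)
open import Relation.Nullary using (¬_)
open import Relation.Nullary.Decidable using (⌊_⌋)
open import Relation.Binary.PropositionalEquality using (_≡_)

ℕ→ℚ : ℕ → ℚ
ℕ→ℚ n = (+ n) / 1

ValidItem : ℚ → Set
ValidItem x = (0ℚ < x) × (x ≤ 1ℚ)

ValidInput : List ℚ → Set
ValidInput I = All ValidItem I

binLoad : {k : ℕ} → List ℚ → List (Fin k) → Fin k → ℚ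
binLoad (x ∷ xs) (b ∷ bs) j = (if ⌊ b ≟ᶠ j ⌋ then x else 0ℚ) + binLoad xs bs j
binLoad _ _ j = 0ℚ

Packable : ℕ → List ℚ → Set
Packable k I = Σ (List (Fin k)) λ bs →
  (length bs ≡ length I) × (∀ j → binLoad I bs j ≤ 1ℚ)

IsOPT : List ℚ → ℕ → Set
IsOPT I Q = Packable Q I × (∀ k → k ℕ.< Q → ¬ Packable k I)

-- Deterministic online algorithms for the K-O variant.
-- decide Q prev x : bin for the next item x, given the announced optimal
-- cost Q and the previously revealed items prev (in arrival order).
-- Bins are numbered in order of opening; an index that is not the index
-- of an already open bin means "open a new bin".
record OnlineAlg : Set where
  field
    decide : ℕ → List ℚ → ℚ → ℕ
open OnlineAlg public

place : List ℚ → ℕ → ℚ → List ℚ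
place [] d x = x ∷ []
place (l ∷ ls) zero x = (l + x) ∷ ls
place (l ∷ ls) (suc d) x = l ∷ place ls d x

runFrom : OnlineAlg → ℕ → List ℚ → List ℚ → List ℚ → List ℚ
runFrom A Q loads prev [] = loads
runFrom A Q loads prev (x ∷ xs) =
  runFrom A Q (place loads (decide A Q prev x) x) (prev ++ (x ∷ [])) xs

finalLoads : OnlineAlg → ℕ → List ℚ → List ℚ
finalLoads A Q I = runFrom A Q [] [] I

cost : OnlineAlg → ℕ → List ℚ → ℕ
cost A Q I = length (finalLoads A Q I)

-- The packing produced is feasible (every bin load at most 1; loads only
-- grow, so this is equivalent to feasibility after every step).
ValidRun : OnlineAlg → ℕ → List ℚ → Set
ValidRun A Q I = All (_≤ 1ℚ) (finalLoads A Q I)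

Legal : OnlineAlg → Set
Legal A = ∀ Q I → ValidInput I → IsOPT I Q → ValidRun A Q I

{-# OPTIONS --safe #-}

-- The adversary first presents Q items of size about 1/7 and then Q items of size about 1/3. Their
-- exact sizes are fixed by bisection while the algorithm packs them: in each of the two phases the
-- items that open a bin (large) end up larger than all the others (small). The input ends with equal
-- items longer than 1/2, so that the algorithm opens a new bin for each of them, except for those that
-- fit into a bin already open. There are five endings. After the first phase: items that fit with one
-- small seventh only, or with one seventh but not with two. After the second phase: items slightly
-- above 1/2, items that fit with one small third or with two sevenths but not with a large third or
-- with three sevenths, or items of size 1. Each ending can be completed by tiny items to an input of
-- total size Q that fits into Q bins. Weighting the bins of the algorithm by a feasible solution of the
-- dual linear program shows that one of the five endings costs at least 87/62 Q - O(1).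

module Submission where

open import Defs
open import Data.Bool using (Bool; true; false; if_then_else_; T; _∧_; _∨_)
open import Data.Bool.Properties using (T-∨)
open import Data.Fin using (Fin; zero; suc; toℕ; fromℕ<)
open import Data.Fin.Properties using (toℕ-fromℕ<) renaming (_≟_ to _≟ᶠ_)
open import Data.Integer as ℤ using ()
import Data.Integer.Properties as ℤₚ
open import Data.List using (List; []; _∷_; _++_; length; map; replicate; take; drop)
open import Data.List.Properties using (length-++; length-map; length-replicate; ++-assoc; ++-identityʳ; take++drop≡id; length-take; length-drop; map-++)
open import Data.List.Relation.Binary.Permutation.Propositional using (_↭_; ↭-refl; ↭-sym; ↭-trans; ↭-reflexive; prep; swap; module PermutationReasoning) renaming (refl to ↭-base; trans to ↭-step)
open import Data.List.Relation.Binary.Permutation.Propositional.Properties using (All-resp-↭; ++⁺; ++⁺ˡ; ++⁺ʳ; ++-comm; shift; shifts; ↭-length)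
open import Data.List.Relation.Unary.All as All using (All; []; _∷_)
import Data.List.Relation.Unary.All.Properties as Allₚ
open import Data.Nat using (ℕ; zero; suc; _≥_; _+_; _*_; _≤_; _<_; _∸_; _^_; _≤ᵇ_; _<ᵇ_; _<?_; z≤n; s≤s; >-nonZero)
open import Data.Nat.DivMod using (_/_; m≡m%n+[m/n]*n; m%n<n; m/n*n≤m)
open import Data.Nat.ListAction using (sum)
open import Data.Nat.ListAction.Properties using (sum-++; sum-↭)
open import Data.Nat.Properties
open import Data.Product using (Σ; _×_; _,_; proj₁; proj₂)
open import Data.Rational as ℚ using (ℚ; mkℚ; 0ℚ; 1ℚ; toℚᵘ; 1/_; ↧ₙ_)
import Data.Rational.Properties as ℚₚ
import Data.Rational.Unnormalised as ℚᵘ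
import Data.Rational.Unnormalised.Properties as ℚᵘₚ
open import Data.Sum using (_⊎_; inj₁; inj₂; [_,_]′)
open import Data.Unit using (⊤; tt)
open import Data.Vec as Vec using (Vec; []; _∷_; lookup; zipWith; tabulate)
open import Data.Vec.N-ary using (N-ary; _$ⁿ_)
open import Data.Vec.Relation.Unary.All as VAll using ([]; _∷_) renaming (All to VAll)
import Data.Vec.Relation.Unary.All.Properties as VAllₚ
open import Function using (_∘_)
open import Function.Bundles using (Equivalence)
open import Relation.Binary.PropositionalEquality using (_≡_; refl; sym; trans; cong; cong₂; subst; subst₂; module ≡-Reasoning)
open import Relation.Nullary using (Dec; yes; no; contradiction)
open import Relation.Nullary.Decidable using (⌊_⌋)

-- Linear arithmetic over ℕ by Farkas certificates

infixl 6 _⊕_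
infixl 7 _⊗_
infix 5 _≼_
infix 4 _∙_
infixr 2 _&_
infix 1 _⊢_

data Lin (n : ℕ) : Set where
  var : Fin n → Lin n
  con : ℕ → Lin n
  _⊕_ : Lin n → Lin n → Lin n
  _⊗_ : ℕ → Lin n → Lin n

⟦_⟧ : ∀ {n} → Lin n → Vec ℕ n → ℕ
⟦ var i ⟧ ρ = lookup ρ i
⟦ con k ⟧ ρ = k
⟦ a ⊕ b ⟧ ρ = ⟦ a ⟧ ρ + ⟦ b ⟧ ρ
⟦ k ⊗ a ⟧ ρ = k * ⟦ a ⟧ ρ

record Ineq (n : ℕ) : Set where
  constructor _≼_
  field lhs rhs : Lin n
open Ineq

data Combination (n : ℕ) : Set where
  ∅   : Combination n
  _&_ : ℕ × Ineq n → Combination n → Combination n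

_∙_ : ∀ {n} → ℕ → Ineq n → ℕ × Ineq n
_∙_ = _,_

record Sequent (n : ℕ) : Set where
  constructor _⊢_
  field
    premises   : Combination n
    conclusion : ℕ × Ineq n
open Sequent

Holds : ∀ {n} → Vec ℕ n → Ineq n → Set
Holds ρ (a ≼ b) = ⟦ a ⟧ ρ ≤ ⟦ b ⟧ ρ

AllHold : ∀ {n} → Vec ℕ n → Combination n → Set
AllHold ρ ∅             = ⊤
AllHold ρ ((_ , h) & c) = Holds ρ h × AllHold ρ c

total : ∀ {n} → (Ineq n → Lin n) → Combination n → Lin n
total side ∅             = con 0
total side ((k , h) & c) = k ⊗ side h ⊕ total side c

total-mono : ∀ {n} (ρ : Vec ℕ n) c → AllHold ρ c → ⟦ total lhs c ⟧ ρ ≤ ⟦ total rhs c ⟧ ρ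
total-mono ρ ∅             _        = z≤n
total-mono ρ ((k , h) & c) (p , ps) = +-mono-≤ (*-monoʳ-≤ k p) (total-mono ρ c ps)

constant : ∀ {n} → Lin n → ℕ
constant (var _) = 0
constant (con k) = k
constant (a ⊕ b) = constant a + constant b
constant (k ⊗ a) = k * constant a

coefficient : ∀ {n} → Fin n → Lin n → ℕ
coefficient i (var j) = if ⌊ i ≟ᶠ j ⌋ then 1 else 0
coefficient i (con _) = 0
coefficient i (a ⊕ b) = coefficient i a + coefficient i b
coefficient i (k ⊗ a) = k * coefficient i a

dot : ∀ {n} → (Fin n → ℕ) → Vec ℕ n → ℕ
dot f []      = 0
dot f (x ∷ ρ) = f zero * x + dot (f ∘ suc) ρ

interchange : ∀ a b c d → (a + b) + (c + d) ≡ (a + c) + (b + d)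
interchange a b c d = begin
  (a + b) + (c + d) ≡⟨ +-assoc a b (c + d) ⟩
  a + (b + (c + d)) ≡⟨ cong (a +_) (+-assoc b c d) ⟨
  a + ((b + c) + d) ≡⟨ cong (λ z → a + (z + d)) (+-comm b c) ⟩
  a + ((c + b) + d) ≡⟨ cong (a +_) (+-assoc c b d) ⟩
  a + (c + (b + d)) ≡⟨ +-assoc a c (b + d) ⟨
  (a + c) + (b + d) ∎ where open ≡-Reasoning

dot-cong : ∀ {n} {f g : Fin n → ℕ} → (∀ i → f i ≡ g i) → ∀ ρ → dot f ρ ≡ dot g ρ
dot-cong e []      = refl
dot-cong e (x ∷ ρ) = cong₂ _+_ (cong (_* x) (e zero)) (dot-cong (e ∘ suc) ρ)

dot-0 : ∀ {n} (ρ : Vec ℕ n) → dot (λ _ → 0) ρ ≡ 0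
dot-0 []      = refl
dot-0 (x ∷ ρ) = dot-0 ρ

dot-+ : ∀ {n} (f g : Fin n → ℕ) ρ → dot (λ i → f i + g i) ρ ≡ dot f ρ + dot g ρ
dot-+ f g []      = refl
dot-+ f g (x ∷ ρ) = trans
  (cong₂ _+_ (*-distribʳ-+ x (f zero) (g zero)) (dot-+ (f ∘ suc) (g ∘ suc) ρ))
  (interchange (f zero * x) (g zero * x) _ _)

dot-* : ∀ {n} k (f : Fin n → ℕ) ρ → dot (λ i → k * f i) ρ ≡ k * dot f ρ
dot-* k f []      = sym (*-zeroʳ k)
dot-* k f (x ∷ ρ) = trans
  (cong₂ _+_ (*-assoc k (f zero) x) (dot-* k (f ∘ suc) ρ))
  (sym (*-distribˡ-+ k _ _))

dot-unit : ∀ {n} (j : Fin n) ρ → dot (λ i → if ⌊ i ≟ᶠ j ⌋ then 1 else 0) ρ ≡ lookup ρ j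
dot-unit zero    (x ∷ ρ) = trans (cong₂ _+_ (*-identityˡ x) (dot-0 ρ)) (+-identityʳ x)
dot-unit (suc j) (x ∷ ρ) = trans (dot-cong unit-suc ρ) (dot-unit j ρ)
  where
  unit-suc : ∀ i → (if ⌊ suc i ≟ᶠ suc j ⌋ then 1 else 0) ≡ (if ⌊ i ≟ᶠ j ⌋ then 1 else 0)
  unit-suc i with i ≟ᶠ j
  ... | yes _ = refl
  ... | no  _ = refl

dot-mono : ∀ {n} {f g : Fin n → ℕ} → (∀ i → f i ≤ g i) → ∀ ρ → dot f ρ ≤ dot g ρ
dot-mono e []      = z≤n
dot-mono e (x ∷ ρ) = +-mono-≤ (*-monoˡ-≤ x (e zero)) (dot-mono (e ∘ suc) ρ)

normal-form : ∀ {n} (a : Lin n) ρ → ⟦ a ⟧ ρ ≡ constant a + dot (λ i → coefficient i a) ρ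
normal-form (var j) ρ = sym (dot-unit j ρ)
normal-form (con k) ρ = sym (trans (cong (k +_) (dot-0 ρ)) (+-identityʳ k))
normal-form (a ⊕ b) ρ = trans (cong₂ _+_ (normal-form a ρ) (normal-form b ρ))
  (trans (interchange (constant a) _ (constant b) _)
         (cong (constant a + constant b +_) (sym (dot-+ _ _ ρ))))
normal-form (k ⊗ a) ρ = trans (cong (k *_) (normal-form a ρ))
  (trans (*-distribˡ-+ k (constant a) _) (cong (k * constant a +_) (sym (dot-* k _ ρ))))

allᵇ : ∀ {n} → (Fin n → Bool) → Bool
allᵇ {zero}  p = true
allᵇ {suc n} p = p zero ∧ allᵇ (p ∘ suc)

T-∧ : ∀ x {y} → T (x ∧ y) → T x × T y
T-∧ true t = tt , t

allᵇ-sound : ∀ {n} (p : Fin n → Bool) → T (allᵇ p) → ∀ i → T (p i)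
allᵇ-sound p t zero    = proj₁ (T-∧ (p zero) t)
allᵇ-sound p t (suc i) = allᵇ-sound (p ∘ suc) (proj₂ (T-∧ (p zero) t)) i

-- Variables stand for natural numbers, so comparing constants and coefficients is a sufficient
-- test.
_≼ᵇ_ : ∀ {n} → Lin n → Lin n → Bool
a ≼ᵇ b = (constant a ≤ᵇ constant b) ∧ allᵇ (λ i → coefficient i a ≤ᵇ coefficient i b)

≼ᵇ-sound : ∀ {n} (a b : Lin n) → T (a ≼ᵇ b) → ∀ ρ → ⟦ a ⟧ ρ ≤ ⟦ b ⟧ ρ
≼ᵇ-sound a b t ρ rewrite normal-form a ρ | normal-form b ρ =
  let c , d = T-∧ (constant a ≤ᵇ constant b) t in
  +-mono-≤ (≤ᵇ⇒≤ _ _ c) (dot-mono (λ i → ≤ᵇ⇒≤ _ _ (allᵇ-sound _ d i)) ρ)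

-- The multiplier of the conclusion is written as its predecessor, so that it is positive.
valid : ∀ {n} → Sequent n → Bool
valid (c ⊢ (k , a ≼ b)) = (suc k ⊗ a ⊕ total rhs c) ≼ᵇ (suc k ⊗ b ⊕ total lhs c)

vars : ∀ {n} → Vec (Lin n) n
vars = tabulate var

-- The premises bound `total lhs c` by `total rhs c`; chaining this with the checked inequality and
-- cancelling leaves `suc k` times the conclusion.
entails : ∀ {n} (ρ : Vec ℕ n) (s : Sequent n) → T (valid s) →
  AllHold ρ (premises s) → Holds ρ (proj₂ (conclusion s))
entails ρ (c ⊢ (k , a ≼ b)) t ps = *-cancelˡ-≤ (suc k) (+-cancelʳ-≤ (⟦ total rhs c ⟧ ρ) _ _
  (≤-trans (≼ᵇ-sound (suc k ⊗ a ⊕ total rhs c) (suc k ⊗ b ⊕ total lhs c) t ρ)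
           (+-monoʳ-≤ (suc k * ⟦ b ⟧ ρ) (total-mono ρ c ps))))

-- For a correct certificate the implicit condition evaluates to `⊤` and is filled in automatically.
-- Giving the sequent as a function names the entries of `ρ` by bound variables.
farkas : ∀ {n} (ρ : Vec ℕ n) (s : N-ary n (Lin n) (Sequent n)) → let sequent = s $ⁿ vars in
  {T (valid sequent)} → AllHold ρ (premises sequent) → Holds ρ (proj₂ (conclusion sequent))
farkas ρ s {t} = entails ρ (s $ⁿ vars) t

-- Packings of natural-number sizes

contents : ∀ {k} → Vec (List ℕ) k → List ℕ
contents []       = []
contents (b ∷ bs) = b ++ contents bs

record Fits (c k : ℕ) (I : List ℕ) : Set where
  constructor packing
  field
    bins     : Vec (List ℕ) k
    capacity : VAll (λ b → sum b ≤ c) bins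
    complete : contents bins ↭ I

contents-zipWith-++ : ∀ {k} (bs cs : Vec (List ℕ) k) →
  contents (zipWith _++_ bs cs) ↭ contents bs ++ contents cs
contents-zipWith-++ []       []       = ↭-refl
contents-zipWith-++ (b ∷ bs) (c ∷ cs) = ↭-trans
  (↭-reflexive (++-assoc b c _))
  (↭-trans (++⁺ˡ b (↭-trans (++⁺ˡ c (contents-zipWith-++ bs cs)) (shifts c (contents bs))))
           (↭-reflexive (sym (++-assoc b (contents bs) _))))

contents-++ : ∀ {k l} (bs : Vec (List ℕ) k) (cs : Vec (List ℕ) l) →
  contents (bs Vec.++ cs) ≡ contents bs ++ contents cs
contents-++ []       cs = refl
contents-++ (b ∷ bs) cs = trans (cong (b ++_) (contents-++ bs cs)) (sym (++-assoc b _ _))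

Fits-resp-↭ : ∀ {c k I J} → I ↭ J → Fits c k I → Fits c k J
Fits-resp-↭ σ (packing bs ok σ′) = packing bs ok (↭-trans σ′ σ)

Fits-weaken : ∀ {c d k I} → c ≤ d → Fits c k I → Fits d k I
Fits-weaken c≤d (packing bs ok σ) = packing bs (VAll.map (λ p → ≤-trans p c≤d) ok) σ

-- Two packings into the same bins are laid over each other, so that each kind of item can be given
-- its own share of the capacity.
Fits-merge : ∀ {c d k I J} → Fits c k I → Fits d k J → Fits (c + d) k (I ++ J)
Fits-merge {c} {d} (packing bs ok σ) (packing cs ok′ σ′) =
  packing (zipWith _++_ bs cs) (zip-capacity ok ok′)
    (↭-trans (contents-zipWith-++ bs cs) (++⁺ σ σ′))
  where
  zip-capacity : ∀ {k} {bs cs : Vec (List ℕ) k} → VAll (λ b → sum b ≤ c) bs →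
    VAll (λ b → sum b ≤ d) cs → VAll (λ b → sum b ≤ c + d) (zipWith _++_ bs cs)
  zip-capacity []       []       = []
  zip-capacity {bs = b ∷ _} {c ∷ _} (p ∷ ps) (q ∷ qs) =
    ≤-trans (≤-reflexive (sum-++ b c)) (+-mono-≤ p q) ∷ zip-capacity ps qs

Fits-union : ∀ {c k l I J} → Fits c k I → Fits c l J → Fits c (k + l) (I ++ J)
Fits-union {c} (packing bs ok σ) (packing cs ok′ σ′) =
  packing (bs Vec.++ cs) (++-capacity ok ok′)
    (↭-trans (↭-reflexive (contents-++ bs cs)) (++⁺ σ σ′))
  where
  ++-capacity : ∀ {k l} {bs : Vec (List ℕ) k} {cs : Vec (List ℕ) l} → VAll (λ b → sum b ≤ c) bs →
    VAll (λ b → sum b ≤ c) cs → VAll (λ b → sum b ≤ c) (bs Vec.++ cs)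
  ++-capacity []       qs = qs
  ++-capacity (p ∷ ps) qs = p ∷ ++-capacity ps qs

sum-bounded : ∀ {α} {I} → All (_≤ α) I → sum I ≤ length I * α
sum-bounded []       = z≤n
sum-bounded (p ∷ ps) = +-mono-≤ p (sum-bounded ps)

Fits-uniform : ∀ p k {α I} → All (_≤ α) I → length I ≤ k * p → Fits (p * α) k I
Fits-uniform p zero    {I = []}    _    _ = packing [] [] ↭-refl
Fits-uniform p (suc k) {α} {I} small len =
  let packing bs ok σ = Fits-uniform p k (Allₚ.drop⁺ p small)
        (≤-trans (≤-reflexive (length-drop p I))
          (≤-trans (∸-monoˡ-≤ p len) (≤-reflexive (m+n∸m≡n p (k * p)))))
  in packing (take p I ∷ bs)
       (≤-trans (sum-bounded (Allₚ.take⁺ p small))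
          (*-monoˡ-≤ α (≤-trans (≤-reflexive (length-take p I)) (m⊓n≤m p _))) ∷ ok)
       (↭-trans (++⁺ˡ (take p I) σ) (↭-reflexive (take++drop≡id p I)))

Fits-replicate : ∀ k e → Fits e k (replicate k e)
Fits-replicate k e = Fits-weaken (≤-reflexive (*-identityˡ e))
  (Fits-uniform 1 k (Allₚ.replicate⁺ k ≤-refl) (≤-reflexive (trans (length-replicate k) (sym (*-identityʳ k)))))

-- Filling every bin up with unit items makes the total size k * c, so that no smaller number of
-- bins suffices.
Fits-fill : ∀ {c k I} → Fits c k I →
  Σ (List ℕ) λ J → All (_≡ 1) J × Fits c k (I ++ J) × sum (I ++ J) ≡ k * c
Fits-fill {c} {k} {I} (packing bs ok σ) =
  let J , ones , packing bs′ ok′ σ′ , eq = fill bs ok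
      τ = ++⁺ʳ J σ
  in J , ones , packing bs′ ok′ (↭-trans σ′ τ) , trans (sym (sum-↭ τ)) eq
  where
  sum-ones : ∀ n → sum (replicate n 1) ≡ n
  sum-ones zero    = refl
  sum-ones (suc n) = cong suc (sum-ones n)

  fill : ∀ {k} (bs : Vec (List ℕ) k) → VAll (λ b → sum b ≤ c) bs →
    Σ (List ℕ) λ J → All (_≡ 1) J × Fits c k (contents bs ++ J) × sum (contents bs ++ J) ≡ k * c
  fill []       []       = [] , [] , packing [] [] ↭-refl , refl
  fill (b ∷ bs) (p ∷ ps) =
    let J , ones , packing bs′ ok σ , eq = fill bs ps
        new = replicate (c ∸ sum b) 1
        full : sum (b ++ new) ≡ c
        full = trans (sum-++ b new) (trans (cong (sum b +_) (sum-ones (c ∸ sum b))) (m+[n∸m]≡n p))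
        τ : (b ++ new) ++ (contents bs ++ J) ↭ (b ++ contents bs) ++ (new ++ J)
        τ = ↭-trans (↭-reflexive (++-assoc b new _))
              (↭-trans (++⁺ˡ b (shifts new (contents bs))) (↭-reflexive (sym (++-assoc b (contents bs) _))))
    in new ++ J , Allₚ.++⁺ (Allₚ.replicate⁺ (c ∸ sum b) refl) ones ,
       packing ((b ++ new) ∷ bs′) (≤-reflexive full ∷ ok) (↭-trans (++⁺ˡ (b ++ new) σ) τ) ,
       trans (sym (sum-↭ τ)) (trans (sum-++ (b ++ new) _) (cong₂ _+_ full eq))

-- Packings as assignments of items to bins

load : ∀ {k} → List ℕ → List (Fin k) → Fin k → ℕ
load (x ∷ xs) (b ∷ bs) j = (if ⌊ b ≟ᶠ j ⌋ then x else 0) + load xs bs j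
load _ _ j = 0

-- Prescribing the loads exactly, and not only bounding them, lets an assignment follow a
-- permutation one step at a time.
Assignment : (k : ℕ) → List ℕ → (Fin k → ℕ) → Set
Assignment k I f = Σ (List (Fin k)) λ bs → (length bs ≡ length I) × (∀ j → load I bs j ≡ f j)

Assignment-resp-↭ : ∀ {k I J f} → I ↭ J → Assignment k I f → Assignment k J f
Assignment-resp-↭ ↭-base a = a
Assignment-resp-↭ {f = f} (prep x σ) (b ∷ bs , len , eq) =
  let bs′ , len′ , eq′ = Assignment-resp-↭ σ (bs , cong (_∸ 1) len , λ j → refl)
  in b ∷ bs′ , cong suc len′ ,
     λ j → trans (cong ((if ⌊ b ≟ᶠ j ⌋ then x else 0) +_) (eq′ j)) (eq j)
Assignment-resp-↭ (swap {xs} {ys} x y σ) (b ∷ c ∷ bs , len , eq) =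
  let bs′ , len′ , eq′ = Assignment-resp-↭ σ (bs , cong (_∸ 2) len , λ j → refl)
  in c ∷ b ∷ bs′ , cong (2 +_) len′ ,
     λ j → trans (exchange (if ⌊ c ≟ᶠ j ⌋ then y else 0) (if ⌊ b ≟ᶠ j ⌋ then x else 0) (eq′ j)) (eq j)
  where
  exchange : ∀ u v {r s} → r ≡ s → u + (v + r) ≡ v + (u + s)
  exchange u v {r} refl = trans (sym (+-assoc u v r)) (trans (cong (_+ r) (+-comm u v)) (+-assoc v u r))
Assignment-resp-↭ (↭-step σ τ) a = Assignment-resp-↭ τ (Assignment-resp-↭ σ a)

load-map-suc-zero : ∀ {k} I (bs : List (Fin k)) → load I (map suc bs) zero ≡ 0
load-map-suc-zero []      []       = refl
load-map-suc-zero []      (b ∷ bs) = refl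
load-map-suc-zero (x ∷ I) []       = refl
load-map-suc-zero (x ∷ I) (b ∷ bs) = load-map-suc-zero I bs

load-map-suc-suc : ∀ {k} I (bs : List (Fin k)) j → load I (map suc bs) (suc j) ≡ load I bs j
load-map-suc-suc []      []       j = refl
load-map-suc-suc []      (b ∷ bs) j = refl
load-map-suc-suc (x ∷ I) []       j = refl
load-map-suc-suc (x ∷ I) (b ∷ bs) j with b ≟ᶠ j
... | yes _ = cong (x +_) (load-map-suc-suc I bs j)
... | no  _ = load-map-suc-suc I bs j

contents-Assignment : ∀ {k} (bs : Vec (List ℕ) k) → Assignment k (contents bs) (sum ∘ lookup bs)
contents-Assignment []       = [] , refl , λ ()
contents-Assignment (b ∷ bs) with contents-Assignment bs
... | as , len , eq = extend b
  where
  extend : ∀ c → Assignment _ (c ++ contents bs) (sum ∘ lookup (c ∷ bs))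
  extend [] = map suc as , trans (length-map suc as) len ,
    λ { zero    → load-map-suc-zero (contents bs) as
      ; (suc j) → trans (load-map-suc-suc (contents bs) as j) (eq j) }
  extend (x ∷ c) with extend c
  ... | as′ , len′ , eq′ = zero ∷ as′ , cong suc len′ ,
    λ { zero → cong (x +_) (eq′ zero) ; (suc j) → eq′ (suc j) }

Fits-Assignment : ∀ {c k I} → Fits c k I →
  Σ (List (Fin k)) λ bs → (length bs ≡ length I) × (∀ j → load I bs j ≤ c)
Fits-Assignment (packing bins ok σ) =
  let bs , len , eq = Assignment-resp-↭ σ (contents-Assignment bins)
  in bs , len , λ j → ≤-trans (≤-reflexive (eq j)) (VAllₚ.lookup⁺ ok j)

Σ-Fin : ∀ {k} → (Fin k → ℕ) → ℕ
Σ-Fin {zero}  f = 0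
Σ-Fin {suc k} f = f zero + Σ-Fin (f ∘ suc)

Σ-Fin-≤ : ∀ {k c} {f : Fin k → ℕ} → (∀ j → f j ≤ c) → Σ-Fin f ≤ k * c
Σ-Fin-≤ {zero}  p = z≤n
Σ-Fin-≤ {suc k} p = +-mono-≤ (p zero) (Σ-Fin-≤ (p ∘ suc))

Σ-Fin-0 : ∀ k → Σ-Fin {k} (λ _ → 0) ≡ 0
Σ-Fin-0 zero    = refl
Σ-Fin-0 (suc k) = Σ-Fin-0 k

Σ-Fin-cong : ∀ {k} {f g : Fin k → ℕ} → (∀ j → f j ≡ g j) → Σ-Fin f ≡ Σ-Fin g
Σ-Fin-cong {zero}  e = refl
Σ-Fin-cong {suc k} e = cong₂ _+_ (e zero) (Σ-Fin-cong (e ∘ suc))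

Σ-Fin-+ : ∀ {k} (f g : Fin k → ℕ) → Σ-Fin (λ j → f j + g j) ≡ Σ-Fin f + Σ-Fin g
Σ-Fin-+ {zero}  f g = refl
Σ-Fin-+ {suc k} f g = trans (cong (f zero + g zero +_) (Σ-Fin-+ (f ∘ suc) (g ∘ suc)))
  (interchange (f zero) (g zero) _ _)

Σ-Fin-single : ∀ {k} (b : Fin k) x → Σ-Fin (λ j → if ⌊ b ≟ᶠ j ⌋ then x else 0) ≡ x
Σ-Fin-single {suc k} zero    x = trans (cong (x +_) (Σ-Fin-0 k)) (+-identityʳ x)
Σ-Fin-single {suc k} (suc b) x = trans (Σ-Fin-cong shifted) (Σ-Fin-single b x)
  where
  shifted : ∀ j → (if ⌊ suc b ≟ᶠ suc j ⌋ then x else 0) ≡ (if ⌊ b ≟ᶠ j ⌋ then x else 0)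
  shifted j with b ≟ᶠ j
  ... | yes _ = refl
  ... | no  _ = refl

-- Double counting: each item contributes to the load of exactly one bin.
Σ-load : ∀ {k} I (bs : List (Fin k)) → length bs ≡ length I → Σ-Fin (load I bs) ≡ sum I
Σ-load {k} []      []       _   = Σ-Fin-0 k
Σ-load     (x ∷ I) (b ∷ bs) len = trans (Σ-Fin-+ _ (load I bs))
  (cong₂ _+_ (Σ-Fin-single b x) (Σ-load I bs (cong (_∸ 1) len)))

sum≤capacity : ∀ {k c} I (bs : List (Fin k)) → length bs ≡ length I → (∀ j → load I bs j ≤ c) →
  sum I ≤ k * c
sum≤capacity I bs len ok = ≤-trans (≤-reflexive (sym (Σ-load I bs len))) (Σ-Fin-≤ ok)

-- Runs of an online algorithm on natural-number sizes

-- Generic in the kind of bin: the same step acts on plain loads and on bins that also record their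
-- item counts, and `map-put` relates the two.
put : {B : Set} → (B → B) → B → List B → ℕ → List B
put g e []       d       = g e ∷ []
put g e (b ∷ bs) zero    = g b ∷ bs
put g e (b ∷ bs) (suc d) = b ∷ put g e bs d

map-put : ∀ {B C : Set} (h : B → C) {g : B → B} {g′ : C → C} {e e′} →
  (∀ b → h (g b) ≡ g′ (h b)) → h e ≡ e′ →
  ∀ bs d → map h (put g e bs d) ≡ put g′ e′ (map h bs) d
map-put h com refl []       d       = cong (_∷ []) (com _)
map-put h com refl (b ∷ bs) zero    = cong (_∷ map h bs) (com b)
map-put h com refl (b ∷ bs) (suc d) = cong (h b ∷_) (map-put h com refl bs d)

Decision : Set
Decision = List ℕ → ℕ → ℕ

run : Decision → List ℕ → List ℕ → List ℕ → List ℕ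
run dec ls prev []       = ls
run dec ls prev (x ∷ xs) = run dec (put (_+ x) 0 ls (dec prev x)) (prev ++ x ∷ []) xs

run-++ : ∀ dec ls prev I J → run dec ls prev (I ++ J) ≡ run dec (run dec ls prev I) (prev ++ I) J
run-++ dec ls prev []      J = cong (λ p → run dec ls p J) (sym (++-identityʳ prev))
run-++ dec ls prev (x ∷ I) J = trans
  (run-++ dec _ (prev ++ x ∷ []) I J)
  (cong (λ p → run dec (run dec ls prev (x ∷ I)) p J) (++-assoc prev (x ∷ []) I))

put-bounded : ∀ {D} x ls d → All (_≤ D) (put (_+ x) 0 ls d) → All (_≤ D) ls
put-bounded x []       d       _        = []
put-bounded x (ℓ ∷ ls) zero    (p ∷ ps) = ≤-trans (m≤m+n ℓ x) p ∷ ps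
put-bounded x (ℓ ∷ ls) (suc d) (p ∷ ps) = p ∷ put-bounded x ls d ps

run-bounded : ∀ {D} dec ls prev I → All (_≤ D) (run dec ls prev I) → All (_≤ D) ls
run-bounded dec ls prev []      ps = ps
run-bounded dec ls prev (x ∷ I) ps = put-bounded x ls _ (run-bounded dec _ _ I ps)

length-put : ∀ {B : Set} (g : B → B) e bs d → length bs ≤ length (put g e bs d)
length-put g e []       d       = z≤n
length-put g e (b ∷ bs) zero    = ≤-refl
length-put g e (b ∷ bs) (suc d) = s≤s (length-put g e bs d)

length-run : ∀ dec ls prev I → length ls ≤ length (run dec ls prev I)
length-run dec ls prev []      = ≤-refl
length-run dec ls prev (x ∷ I) = ≤-trans (length-put (_+ x) 0 ls _) (length-run dec _ _ I)

full : ℕ → ℕ → ℕ → ℕ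
full D e ℓ = if D <ᵇ ℓ + e then 1 else 0

full-yes : ∀ {D} e ℓ → D < ℓ + e → full D e ℓ ≡ 1
full-yes {D} e ℓ p with D <ᵇ ℓ + e | <⇒<ᵇ p
... | true | _ = refl

full-no : ∀ {D} e ℓ → ℓ + e ≤ D → full D e ℓ ≡ 0
full-no {D} e ℓ p with D <ᵇ ℓ + e in eq
... | false = refl
... | true  = contradiction (<ᵇ⇒< D (ℓ + e) (subst T (sym eq) tt)) (≤⇒≯ p)

full≤1 : ∀ D e ℓ → full D e ℓ ≤ 1
full≤1 D e ℓ with D <ᵇ ℓ + e
... | true  = ≤-refl
... | false = z≤n

Σ-of : {B : Set} → (B → ℕ) → List B → ℕ
Σ-of μ bs = sum (map μ bs)

Σ-of≤length : ∀ {B : Set} {μ : B → ℕ} → (∀ b → μ b ≤ 1) → ∀ bs → Σ-of μ bs ≤ length bs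
Σ-of≤length p []       = z≤n
Σ-of≤length p (b ∷ bs) = +-mono-≤ (p b) (Σ-of≤length p bs)

put-full : ∀ {D e} → D < e + e → ∀ ls d → All (_≤ D) (put (_+ e) 0 ls d) →
  Σ-of (full D e) (put (_+ e) 0 ls d) ≡ suc (Σ-of (full D e) ls)
put-full {D} {e} D<2e [] d _ = cong (_+ 0) (full-yes {D} e e D<2e)
put-full {D} {e} D<2e (ℓ ∷ ls) zero (p ∷ _) = cong₂ _+_
  (trans (full-yes {D} e (ℓ + e)
           (≤-trans D<2e (≤-trans (m≤n+m (e + e) ℓ) (≤-reflexive (sym (+-assoc ℓ e e))))))
         (cong suc (sym (full-no {D} e ℓ p)))) refl
put-full {D} {e} D<2e (ℓ ∷ ls) (suc d) (_ ∷ ps) =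
  trans (cong (full D e ℓ +_) (put-full D<2e ls d ps)) (+-suc (full D e ℓ) _)

-- An item larger than half a bin never goes to a bin that is already too full for it, and makes the
-- bin that receives it too full for a further such item.
run-full : ∀ {D e} → D < e + e → ∀ dec y ls prev → All (_≤ D) (run dec ls prev (replicate y e)) →
  Σ-of (full D e) (run dec ls prev (replicate y e)) ≡ y + Σ-of (full D e) ls
run-full D<2e dec zero    ls prev ok = refl
run-full {D} {e} D<2e dec (suc y) ls prev ok = trans
  (run-full D<2e dec y _ _ ok)
  (trans (cong (y +_) (put-full D<2e ls _ (run-bounded dec _ _ (replicate y e) ok)))
         (+-suc y _))

-- The adaptive phases

record Bin : Set where
  constructor bin
  field sevenths thirds level : ℕ
open Bin

empty : Bin
empty = bin 0 0 0

increase : ℕ → ℕ → ℕ → Bin → Bin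
increase i j x b = bin (i + sevenths b) (j + thirds b) (level b + x)

-- One phase of items of sizes s + a. An item is large if it opens a bin and small otherwise.
-- With n items to come, all small offsets are at most lo, all large ones at least lo + 2 ^ n.
module Phase (dec : Decision) (i j s E : ℕ) (Inv : ℕ → Bin → Set)
  (Inv-mono : ∀ {t u b} → t ≤ u → Inv u b → Inv t b)
  (Inv-add : ∀ {t b} a → 0 < a → Inv t b → Inv t (increase i j (s + a) b))
  (Inv-new : ∀ a → 0 < a → Inv a (increase i j (s + a) empty)) where

  add : ℕ → Bin → Bin
  add = increase i j

  -- Applied to the item counts of a phase, with `c` equal to 1, and to statistics that the phase
  -- leaves alone, with `c` equal to 0.
  Additive : ℕ → List Bin → List Bin → Set
  Additive n bs bs′ = ∀ (μ : Bin → ℕ) c → (∀ x b → μ (add x b) ≡ c + μ b) → μ empty ≡ 0 →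
    Σ-of μ bs′ ≡ n * c + Σ-of μ bs

  -- The threshold `σ` separates the offsets: small ones are at most `σ`, and the invariant at
  -- `suc σ` carries the fact that large ones exceed it.
  record Outcome (n lo : ℕ) (start : List Bin) (prev : List ℕ) : Set where
    field
      items smalls larges : List ℕ
      final               : List Bin
      σ                   : ℕ
      is-run              : run dec (map level start) prev items ≡ map level final
      invariant           : All (Inv (suc σ)) final
      partition           : items ↭ smalls ++ larges
      smalls-≤            : All (_≤ s + σ) smalls
      items-≤             : All (_≤ s + E) items
      positive            : All (0 <_) items
      count               : length items ≡ n
      opened              : length final ≡ length start + length larges
      σ-≥                 : lo ≤ σ
      σ-<                 : σ < lo + 2 ^ n
      additive            : Additive n start final
  open Outcome

  additive-put : ∀ (μ : Bin → ℕ) c → (∀ x b → μ (add x b) ≡ c + μ b) → μ empty ≡ 0 →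
    ∀ x bs d → Σ-of μ (put (add x) empty bs d) ≡ c + Σ-of μ bs
  additive-put μ c step base x []       d       =
    cong (_+ 0) (trans (step x empty) (trans (cong (c +_) base) (+-identityʳ c)))
  additive-put μ c step base x (b ∷ bs) zero    =
    trans (cong (_+ Σ-of μ bs) (step x b)) (+-assoc c (μ b) _)
  additive-put μ c step base x (b ∷ bs) (suc d) = trans
    (cong (μ b +_) (additive-put μ c step base x bs d))
    (trans (sym (+-assoc (μ b) c _)) (trans (cong (_+ Σ-of μ bs) (+-comm (μ b) c)) (+-assoc c (μ b) _)))

  put-old : ∀ {P : Bin → Set} {g} → (∀ {b} → P b → P (g b)) → ∀ {e} bs {d} → d < length bs →
    All P bs → All P (put g e bs d) × length (put g e bs d) ≡ length bs
  put-old keep (b ∷ bs) {zero}  _       (p ∷ ps) = keep p ∷ ps , refl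
  put-old keep (b ∷ bs) {suc d} (s≤s l) (p ∷ ps) =
    let qs , eq = put-old keep bs l ps in p ∷ qs , cong suc eq

  put-new : ∀ {P : Bin → Set} {g e} → P (g e) → ∀ bs {d} → length bs ≤ d →
    All P bs → All P (put g e bs d) × length (put g e bs d) ≡ length bs + 1
  put-new new []       _       []       = new ∷ [] , refl
  put-new new (b ∷ bs) {suc d} (s≤s l) (p ∷ ps) =
    let qs , eq = put-new new bs l ps in p ∷ qs , cong suc eq

  phase : ∀ n lo start prev → lo + 2 ^ n ≤ E → All (Inv (lo + 2 ^ n)) start → Outcome n lo start prev
  phase zero lo start prev _ inv = record
    { items = [] ; smalls = [] ; larges = [] ; final = start ; σ = lo ; is-run = refl
    -- With no items left the upper end is `lo + 2 ^ 0`, that is `suc lo`.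
    ; invariant = subst (λ t → All (Inv t) start) (+-comm lo 1) inv
    ; partition = ↭-refl ; smalls-≤ = [] ; items-≤ = [] ; positive = [] ; count = refl
    ; opened = sym (+-identityʳ _) ; σ-≥ = ≤-refl ; σ-< = m<m+n lo (s≤s z≤n) ; additive = λ _ _ _ _ → refl }
  phase (suc n) lo start prev ≤E inv = step (d <? length start)
    where
    -- The midpoint of the range still open. If the item turns out small, `a` becomes the new lower
    -- end; if it turns out large, the new upper end.
    a = lo + 2 ^ n
    x = s + a
    d = dec prev x
    next = put (add x) empty start d

    a>0 : 0 < a
    a>0 = ≤-trans (m^n>0 2 n) (m≤n+m (2 ^ n) lo)

    a+2^n : a + 2 ^ n ≡ lo + 2 ^ suc n
    a+2^n = trans (+-assoc lo (2 ^ n) (2 ^ n)) (cong (λ z → lo + (2 ^ n + z)) (sym (+-identityʳ (2 ^ n))))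

    a≤top : a ≤ lo + 2 ^ suc n
    a≤top = ≤-trans (m≤m+n a (2 ^ n)) (≤-reflexive a+2^n)

    is-run′ : ∀ I {bs} → run dec (map level next) (prev ++ x ∷ []) I ≡ map level bs →
      run dec (map level start) prev (x ∷ I) ≡ map level bs
    is-run′ I eq = trans (cong (λ ls → run dec ls (prev ++ x ∷ []) I)
      (sym (map-put level (λ b → refl) refl start d))) eq

    additive′ : ∀ bs → Additive n next bs → Additive (suc n) start bs
    additive′ bs hyp μ c st base = trans (hyp μ c st base)
      (trans (cong (n * c +_) (additive-put μ c st base x start d))
        (trans (sym (+-assoc (n * c) c _)) (cong (_+ Σ-of μ start) (+-comm (n * c) c))))

    step : Dec (d < length start) → Outcome (suc n) lo start prev
    step (yes d<) =
      let inv′ , len = put-old (Inv-add a a>0) start d< inv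
          o = phase n a next (prev ++ x ∷ [])
                (≤-trans (≤-reflexive a+2^n) ≤E)
                (subst (λ t → All (Inv t) next) (sym a+2^n) inv′)
      in record
        { items = x ∷ items o ; smalls = x ∷ smalls o ; larges = larges o ; final = final o ; σ = σ o
        ; is-run = is-run′ (items o) (is-run o)
        ; invariant = invariant o
        ; partition = prep x (partition o)
        ; smalls-≤ = +-monoʳ-≤ s (σ-≥ o) ∷ smalls-≤ o
        ; items-≤ = +-monoʳ-≤ s (≤-trans a≤top ≤E) ∷ items-≤ o
        ; positive = ≤-trans a>0 (m≤n+m a s) ∷ positive o
        ; count = cong suc (count o)
        ; opened = trans (opened o) (cong (_+ length (larges o)) len)
        ; σ-≥ = ≤-trans (m≤m+n lo (2 ^ n)) (σ-≥ o)
        ; σ-< = ≤-trans (σ-< o) (≤-reflexive a+2^n)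
        ; additive = additive′ (final o) (additive o) }
    step (no d≮) =
      let inv′ , len = put-new (Inv-new a a>0) start (≮⇒≥ d≮) (All.map (Inv-mono a≤top) inv)
          o = phase n lo next (prev ++ x ∷ []) (≤-trans a≤top ≤E) inv′
      in record
        { items = x ∷ items o ; smalls = smalls o ; larges = x ∷ larges o ; final = final o ; σ = σ o
        ; is-run = is-run′ (items o) (is-run o)
        ; invariant = invariant o
        ; partition = ↭-trans (prep x (partition o)) (↭-sym (shift x (smalls o) (larges o)))
        ; smalls-≤ = smalls-≤ o
        ; items-≤ = +-monoʳ-≤ s (≤-trans a≤top ≤E) ∷ items-≤ o
        ; positive = ≤-trans a>0 (m≤n+m a s) ∷ positive o
        ; count = cong suc (count o)
        ; opened = trans (opened o) (trans (cong (_+ length (larges o)) len) (+-assoc (length start) 1 _))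
        ; σ-≥ = σ-≥ o
        ; σ-< = ≤-trans (σ-< o) a≤top
        ; additive = additive′ (final o) (additive o) }

-- From natural-number sizes to rational ones

toℚᵘ-ℕ→ℚ : ∀ n → toℚᵘ (ℕ→ℚ n) ℚᵘ.≃ ℚᵘ.mkℚᵘ (ℤ.+ n) 0
toℚᵘ-ℕ→ℚ n = ℚₚ.toℚᵘ-fromℚᵘ (ℚᵘ.mkℚᵘ (ℤ.+ n) 0)

ℕ→ℚ-+ : ∀ m n → ℕ→ℚ (m + n) ≡ ℕ→ℚ m ℚ.+ ℕ→ℚ n
ℕ→ℚ-+ m n = ℚₚ.toℚᵘ-injective (begin
  toℚᵘ (ℕ→ℚ (m + n))                          ≈⟨ toℚᵘ-ℕ→ℚ (m + n) ⟩
  ℚᵘ.mkℚᵘ (ℤ.+ (m + n)) 0                     ≈⟨ ℚᵘ.*≡* (cong (ℤ._* ℤ.+ 1) (cong₂ ℤ._+_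
                                                   (sym (ℤₚ.*-identityʳ (ℤ.+ m)))
                                                   (sym (ℤₚ.*-identityʳ (ℤ.+ n))))) ⟩
  ℚᵘ.mkℚᵘ (ℤ.+ m) 0 ℚᵘ.+ ℚᵘ.mkℚᵘ (ℤ.+ n) 0    ≈⟨ ℚᵘₚ.+-cong (toℚᵘ-ℕ→ℚ m) (toℚᵘ-ℕ→ℚ n) ⟨
  toℚᵘ (ℕ→ℚ m) ℚᵘ.+ toℚᵘ (ℕ→ℚ n)              ≈⟨ ℚₚ.toℚᵘ-homo-+ (ℕ→ℚ m) (ℕ→ℚ n) ⟨
  toℚᵘ (ℕ→ℚ m ℚ.+ ℕ→ℚ n)                      ∎)
  where open ℚᵘₚ.≃-Reasoning

ℕ→ℚ-mono-≤ : ∀ {m n} → m ≤ n → ℕ→ℚ m ℚ.≤ ℕ→ℚ n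
ℕ→ℚ-mono-≤ {m} {n} m≤n = ℚₚ.toℚᵘ-cancel-≤ (begin
  toℚᵘ (ℕ→ℚ m)    ≃⟨ toℚᵘ-ℕ→ℚ m ⟩
  ℚᵘ.mkℚᵘ (ℤ.+ m) 0 ≤⟨ ℚᵘ.*≤* (ℤₚ.*-monoʳ-≤-nonNeg (ℤ.+ 1) (ℤ.+≤+ m≤n)) ⟩
  ℚᵘ.mkℚᵘ (ℤ.+ n) 0 ≃⟨ toℚᵘ-ℕ→ℚ n ⟨
  toℚᵘ (ℕ→ℚ n)    ∎)
  where open ℚᵘₚ.≤-Reasoning

ℕ→ℚ-mono-< : ∀ {m n} → m < n → ℕ→ℚ m ℚ.< ℕ→ℚ n
ℕ→ℚ-mono-< {m} {n} m<n = ℚₚ.toℚᵘ-cancel-< (begin-strict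
  toℚᵘ (ℕ→ℚ m)    ≃⟨ toℚᵘ-ℕ→ℚ m ⟩
  ℚᵘ.mkℚᵘ (ℤ.+ m) 0 <⟨ ℚᵘ.*<* (ℤₚ.*-monoʳ-<-pos (ℤ.+ 1) (ℤ.+<+ m<n)) ⟩
  ℚᵘ.mkℚᵘ (ℤ.+ n) 0 ≃⟨ toℚᵘ-ℕ→ℚ n ⟨
  toℚᵘ (ℕ→ℚ n)    ∎)
  where open ℚᵘₚ.≤-Reasoning

module Scaling (D : ℕ) (D>0 : 0 < D) where

  private instance
    D-positive : ℚ.Positive (ℕ→ℚ D)
    D-positive = ℚ.positive (ℕ→ℚ-mono-< D>0)

    D-nonZero : ℚ.NonZero (ℕ→ℚ D)
    D-nonZero = ℚₚ.pos⇒nonZero (ℕ→ℚ D)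

    δ-positive : ℚ.Positive (1/ ℕ→ℚ D)
    δ-positive = ℚₚ.1/pos⇒pos (ℕ→ℚ D)

    δ-nonNegative : ℚ.NonNegative (1/ ℕ→ℚ D)
    δ-nonNegative = ℚₚ.pos⇒nonNeg (1/ ℕ→ℚ D)

  scale : ℕ → ℚ
  scale n = ℕ→ℚ n ℚ.* 1/ ℕ→ℚ D

  scale-+ : ∀ m n → scale (m + n) ≡ scale m ℚ.+ scale n
  scale-+ m n = trans (cong (ℚ._* 1/ ℕ→ℚ D) (ℕ→ℚ-+ m n)) (ℚₚ.*-distribʳ-+ (1/ ℕ→ℚ D) (ℕ→ℚ m) (ℕ→ℚ n))

  scale-0 : scale 0 ≡ 0ℚ
  scale-0 = ℚₚ.*-zeroˡ (1/ ℕ→ℚ D)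

  scale-D : scale D ≡ 1ℚ
  scale-D = ℚₚ.*-inverseʳ (ℕ→ℚ D)

  scale-≤1 : ∀ {n} → n ≤ D → scale n ℚ.≤ 1ℚ
  scale-≤1 {n} n≤D = subst (scale n ℚ.≤_) scale-D (ℚₚ.*-monoʳ-≤-nonNeg (1/ ℕ→ℚ D) (ℕ→ℚ-mono-≤ n≤D))

  scale-mono-< : ∀ {m n} → m < n → scale m ℚ.< scale n
  scale-mono-< m<n = ℚₚ.*-monoˡ-<-pos (1/ ℕ→ℚ D) (ℕ→ℚ-mono-< m<n)

  scale-≤1⁻¹ : ∀ {n} → scale n ℚ.≤ 1ℚ → n ≤ D
  scale-≤1⁻¹ {n} p = ≮⇒≥ λ D<n →
    ℚₚ.<-irrefl refl (ℚₚ.<-≤-trans (subst (ℚ._< scale n) scale-D (scale-mono-< D<n)) p)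

  scale-valid : ∀ {n} → 0 < n → n ≤ D → ValidItem (scale n)
  scale-valid {n} 0<n n≤D = subst (ℚ._< scale n) scale-0 (scale-mono-< 0<n) , scale-≤1 n≤D

  binLoad-scale : ∀ {k} I (bs : List (Fin k)) j → binLoad (map scale I) bs j ≡ scale (load I bs j)
  binLoad-scale []      []       j = sym scale-0
  binLoad-scale []      (b ∷ bs) j = sym scale-0
  binLoad-scale (x ∷ I) []       j = sym scale-0
  binLoad-scale (x ∷ I) (b ∷ bs) j with b ≟ᶠ j
  ... | yes _ = trans (cong (scale x ℚ.+_) (binLoad-scale I bs j)) (sym (scale-+ x (load I bs j)))
  ... | no  _ = trans (ℚₚ.+-identityˡ _) (binLoad-scale I bs j)

  Fits-Packable : ∀ {k I} → Fits D k I → Packable k (map scale I)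
  Fits-Packable {k} {I} fits =
    let bs , len , ok = Fits-Assignment fits
    in bs , trans len (sym (length-map scale I)) ,
       λ j → subst (ℚ._≤ 1ℚ) (sym (binLoad-scale I bs j)) (scale-≤1 (ok j))

  Packable-sum : ∀ {k I} → Packable k (map scale I) → sum I ≤ k * D
  Packable-sum {I = I} (bs , len , ok) = sum≤capacity I bs (trans len (length-map scale I))
    λ j → scale-≤1⁻¹ (subst (ℚ._≤ 1ℚ) (binLoad-scale I bs j) (ok j))

  IsOPT-full : ∀ {k I} → Fits D k I → sum I ≡ k * D → IsOPT (map scale I) k
  IsOPT-full {k} {I} fits eq = Fits-Packable fits ,
    λ l l<k p → <⇒≱ l<k (*-cancelʳ-≤ k l D {{>-nonZero D>0}}
      (≤-trans (≤-reflexive (sym eq)) (Packable-sum {I = I} p)))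

  ValidInput-scale : ∀ {I} → All (0 <_) I → All (_≤ D) I → ValidInput (map scale I)
  ValidInput-scale ps qs = Allₚ.map⁺ (All.zipWith (λ (p , q) → scale-valid p q) (ps , qs))

  Fits-items-≤ : ∀ {k I} → Fits D k I → All (_≤ D) I
  Fits-items-≤ (packing bins ok σ) = All-resp-↭ σ (contents-≤ bins ok)
    where
    items-≤-sum : ∀ b → All (_≤ sum b) b
    items-≤-sum []      = []
    items-≤-sum (x ∷ b) = m≤m+n x _ ∷ All.map (λ p → ≤-trans p (m≤n+m _ x)) (items-≤-sum b)

    contents-≤ : ∀ {k} (bs : Vec (List ℕ) k) → VAll (λ b → sum b ≤ D) bs → All (_≤ D) (contents bs)
    contents-≤ []       []       = []
    contents-≤ (b ∷ bs) (p ∷ ps) = Allₚ.++⁺ (All.map (λ q → ≤-trans q p) (items-≤-sum b)) (contents-≤ bs ps)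

  module _ (A : OnlineAlg) (Q : ℕ) where

    decision : Decision
    decision prev x = decide A Q (map scale prev) (scale x)

    place-scale : ∀ ls d x → place (map scale ls) d (scale x) ≡ map scale (put (_+ x) 0 ls d)
    place-scale []       d       x = refl
    place-scale (ℓ ∷ ls) zero    x = cong (_∷ map scale ls) (sym (scale-+ ℓ x))
    place-scale (ℓ ∷ ls) (suc d) x = cong (scale ℓ ∷_) (place-scale ls d x)

    runFrom-scale : ∀ ls prev I →
      runFrom A Q (map scale ls) (map scale prev) (map scale I) ≡ map scale (run decision ls prev I)
    runFrom-scale ls prev []      = refl
    runFrom-scale ls prev (x ∷ I) = trans
      (cong₂ (λ l p → runFrom A Q l p (map scale I))
        (place-scale ls (decision prev x) x) (sym (map-++ scale prev (x ∷ []))))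
      (runFrom-scale _ (prev ++ x ∷ []) I)

    Forces : ℕ → Set
    Forces c = Σ (List ℚ) λ I → ValidInput I × IsOPT I Q × c ≤ cost A Q I

    module _ (legal : Legal A) {I} (positive : All (0 <_) I) (fits : Fits D Q I) where

      private
        filling = Fits-fill fits
        J  = proj₁ filling
        full-input = map scale (I ++ J)
        valid-input : ValidInput full-input
        valid-input = ValidInput-scale
          (Allₚ.++⁺ positive (All.map (λ { refl → s≤s z≤n }) (proj₁ (proj₂ filling))))
          (Fits-items-≤ (proj₁ (proj₂ (proj₂ filling))))
        is-opt : IsOPT full-input Q
        is-opt = IsOPT-full (proj₁ (proj₂ (proj₂ filling))) (proj₂ (proj₂ (proj₂ filling)))
        loads : finalLoads A Q full-input ≡ map scale (run decision (run decision [] [] I) I J)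
        loads = trans (runFrom-scale [] [] (I ++ J)) (cong (map scale) (run-++ decision [] [] I J))

      -- Legality speaks only of inputs with optimal cost `Q`, so it is applied to the filled input;
      -- loads never decrease, so the bound already holds after `I`.
      legal-bounded : All (_≤ D) (run decision [] [] I)
      legal-bounded = run-bounded decision _ I J (All.map scale-≤1⁻¹
        (Allₚ.map⁻ (subst (All (ℚ._≤ 1ℚ)) loads (legal Q full-input valid-input is-opt))))

      -- The filling items arrive last and can only add bins.
      forces : Forces (length (run decision [] [] I))
      forces = full-input , valid-input , is-opt ,
        ≤-trans (length-run decision (run decision [] [] I) I J)
          (≤-reflexive (sym (trans (cong length loads) (length-map scale (run decision (run decision [] [] I) I J)))))

-- The dual solution: weights of bins with i sevenths and j thirds

atLeast1 atLeast2 : ℕ → ℕ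
atLeast1 zero    = 0
atLeast1 (suc _) = 1
atLeast2 0             = 0
atLeast2 1             = 0
atLeast2 (suc (suc _)) = 1

-- In units of 1/42 of a bin, a seventh counts 6 and a third 14. `noHalf` marks the contents that
-- exclude an item slightly above 1/2, `noTwoThirds` those that exclude an item of about 2/3,
-- provided that a bin holding only thirds contains a large one.
noHalf noTwoThirds : ℕ → ℕ → ℕ
noHalf i j = if 21 ≤ᵇ 6 * i + 14 * j then 1 else 0
noTwoThirds 0 0 = 0
noTwoThirds 1 0 = 0
noTwoThirds 2 0 = 0
noTwoThirds _ _ = 1

-- A seventh has price 1 and a third price 2. A bin holds at most 6 sevenths and 2 thirds, so this
-- is a finite check; it is tight for instance at (6, 0), (4, 1) and (2, 2).
dual-feasible : ∀ i j → 6 * i + 14 * j < 42 →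
  i + 2 * j ≤ 2 * noHalf i j + 2 * noTwoThirds i j + atLeast2 i + atLeast1 i
dual-feasible i j bound = subst₂ Dual (toℕ-fromℕ< i<7) (toℕ-fromℕ< j<3)
  (λ below → [ (λ above → contradiction below (≤⇒≯ (≤ᵇ⇒≤ 42 _ above))) , ≤ᵇ⇒≤ _ _ ]′
    (Equivalence.to T-∨ (allᵇ-sound (test a) (allᵇ-sound (λ i → allᵇ (test i)) tt a) b))) bound
  where
  Dual : ℕ → ℕ → Set
  Dual i j = 6 * i + 14 * j < 42 →
    i + 2 * j ≤ 2 * noHalf i j + 2 * noTwoThirds i j + atLeast2 i + atLeast1 i

  test : Fin 7 → Fin 3 → Bool
  test a b = let i = toℕ a ; j = toℕ b in (42 ≤ᵇ 6 * i + 14 * j) ∨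
    (i + 2 * j ≤ᵇ 2 * noHalf i j + 2 * noTwoThirds i j + atLeast2 i + atLeast1 i)

  i<7 : i < 7
  i<7 = *-cancelˡ-< 6 i 7 (≤-<-trans (m≤m+n (6 * i) _) bound)

  j<3 : j < 3
  j<3 = *-cancelˡ-< 14 j 3 (≤-<-trans (m≤n+m (14 * j) (6 * i)) bound)

  a : Fin 7
  a = fromℕ< i<7

  b : Fin 3
  b = fromℕ< j<3

scaled : ∀ E i j → (6 * i + 14 * j) * E ≡ 6 * (i * E) + 14 * (j * E)
scaled E i j = trans (*-distribʳ-+ E (6 * i) (14 * j)) (cong₂ _+_ (*-assoc 6 i E) (*-assoc 14 j E))

full-one : ∀ {D} e ℓ {m} → m ≤ 1 → D < ℓ + e → m ≤ full D e ℓ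
full-one {D} e ℓ m≤1 p = ≤-trans m≤1 (≤-reflexive (sym (full-yes {D} e ℓ p)))

Σ-of-empty : ∀ {B : Set} (μ : B → ℕ) bs → length bs ≡ 0 → Σ-of μ bs ≡ 0
Σ-of-empty μ [] _ = refl

noHalf-≤ : ∀ i j {m} → (21 ≤ 6 * i + 14 * j → 1 ≤ m) → noHalf i j ≤ m
noHalf-≤ i j heavy with 21 ≤ᵇ 6 * i + 14 * j in eq
... | false = z≤n
... | true  = heavy (≤ᵇ⇒≤ 21 _ (subst T (sym eq) tt))

Σ-of-mono : ∀ {B : Set} {μ ν : B → ℕ} {bs} → All (λ b → μ b ≤ ν b) bs → Σ-of μ bs ≤ Σ-of ν bs
Σ-of-mono []       = z≤n
Σ-of-mono (p ∷ ps) = +-mono-≤ p (Σ-of-mono ps)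

Σ-of-one : ∀ {B : Set} (bs : List B) → Σ-of (λ _ → 1) bs ≡ length bs
Σ-of-one []       = refl
Σ-of-one (b ∷ bs) = cong suc (Σ-of-one bs)

Σ-dual : ∀ {bs} → All (λ b → 6 * sevenths b + 14 * thirds b < 42) bs →
  Σ-of sevenths bs + 2 * Σ-of thirds bs ≤
  2 * Σ-of (λ b → noHalf (sevenths b) (thirds b)) bs + 2 * Σ-of (λ b → noTwoThirds (sevenths b) (thirds b)) bs
    + Σ-of (atLeast2 ∘ sevenths) bs + Σ-of (atLeast1 ∘ sevenths) bs
Σ-dual []                 = z≤n
Σ-dual {b ∷ bs} (p ∷ ps) = farkas
  (sevenths b ∷ thirds b ∷ noHalf (sevenths b) (thirds b) ∷ noTwoThirds (sevenths b) (thirds b)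
    ∷ atLeast2 (sevenths b) ∷ atLeast1 (sevenths b)
    ∷ Σ-of sevenths bs ∷ Σ-of thirds bs ∷ Σ-of (λ b → noHalf (sevenths b) (thirds b)) bs
    ∷ Σ-of (λ b → noTwoThirds (sevenths b) (thirds b)) bs
    ∷ Σ-of (atLeast2 ∘ sevenths) bs ∷ Σ-of (atLeast1 ∘ sevenths) bs ∷ [])
  (λ i j h t u v I J H T U V →
    1 ∙ i ⊕ 2 ⊗ j ≼ 2 ⊗ h ⊕ 2 ⊗ t ⊕ u ⊕ v & 1 ∙ I ⊕ 2 ⊗ J ≼ 2 ⊗ H ⊕ 2 ⊗ T ⊕ U ⊕ V & ∅ ⊢
    0 ∙ (i ⊕ I) ⊕ 2 ⊗ (j ⊕ J) ≼ 2 ⊗ (h ⊕ H) ⊕ 2 ⊗ (t ⊕ T) ⊕ (u ⊕ U) ⊕ (v ⊕ V))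
  (dual-feasible (sevenths b) (thirds b) p , Σ-dual ps , tt)

-- The game against one algorithm with announced optimal cost 4 h

module Game (A : OnlineAlg) (legal : Legal A) (h : ℕ) (h>0 : 0 < h)
            (E : ℕ) (2^N≤E : 2 ^ (4 * h) ≤ E) where

  -- `N` is a multiple of 4, so that the offline packings can use exactly a half or a quarter of the
  -- bins. As 1/7 + 1/3 + 1/2 falls short of 1 by 1/42, the capacity `126 * E` leaves `3 * E` for
  -- two offsets of at most `E` and one extra unit.
  N D : ℕ
  N = 4 * h
  D = 126 * E

  E>0 : 0 < E
  E>0 = ≤-trans (m^n>0 2 N) 2^N≤E

  D>0 : 0 < D
  D>0 = ≤-trans E>0 (m≤m+n E _)

  open Scaling D D>0

  dec : Decision
  dec = decision A N

  -- The sevenths have sizes 18 * E + a and the thirds 42 * E + b with 0 < a , b ≤ E. The first item of a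
  -- bin is large, hence has an offset of at least t.
  Inv₁ Inv₃ : ℕ → Bin → Set
  Inv₁ t (bin i j ℓ) = 1 ≤ i × j ≡ 0 × 18 * (i * E) + t ≤ ℓ
  Inv₃ t (bin i j ℓ) = (1 ≤ i × 18 * (i * E) + 42 * (j * E) + 1 ≤ ℓ)
                     ⊎ (i ≡ 0 × 1 ≤ j × 42 * (j * E) + t ≤ ℓ)

  Inv₁-add : ∀ {t b} a → 0 < a → Inv₁ t b → Inv₁ t (bin (1 + sevenths b) (thirds b) (level b + (18 * E + a)))
  Inv₁-add {t} {bin i j ℓ} a _ (_ , j≡0 , p) = s≤s z≤n , j≡0 ,
    farkas (i * E ∷ ℓ ∷ E ∷ t ∷ a ∷ [])
      (λ iE ℓ E t a → 1 ∙ 18 ⊗ iE ⊕ t ≼ ℓ & ∅ ⊢ 0 ∙ 18 ⊗ (E ⊕ iE) ⊕ t ≼ ℓ ⊕ (18 ⊗ E ⊕ a)) (p , tt)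

  Inv₁-new : ∀ a → 0 < a → Inv₁ a (bin 1 0 (18 * E + a))
  Inv₁-new a _ = s≤s z≤n , refl ,
    farkas (E ∷ a ∷ []) (λ E a → ∅ ⊢ 0 ∙ 18 ⊗ (E ⊕ con 0) ⊕ a ≼ 18 ⊗ E ⊕ a) tt

  Inv₁-mono : ∀ {t u b} → t ≤ u → Inv₁ u b → Inv₁ t b
  Inv₁-mono {b = bin i j ℓ} t≤u (1≤i , j≡0 , p) = 1≤i , j≡0 , ≤-trans (+-monoʳ-≤ (18 * (i * E)) t≤u) p

  Inv₃-mono : ∀ {t u b} → t ≤ u → Inv₃ u b → Inv₃ t b
  Inv₃-mono {b = bin i j ℓ} t≤u (inj₁ p)               = inj₁ p
  Inv₃-mono {b = bin i j ℓ} t≤u (inj₂ (i≡0 , 1≤j , p)) = inj₂ (i≡0 , 1≤j , ≤-trans (+-monoʳ-≤ (42 * (j * E)) t≤u) p)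

  Inv₃-add : ∀ {t b} a → 0 < a → Inv₃ t b → Inv₃ t (bin (sevenths b) (1 + thirds b) (level b + (42 * E + a)))
  Inv₃-add {t} {bin i j ℓ} a _ (inj₁ (1≤i , p)) = inj₁ (1≤i ,
    farkas (i * E ∷ j * E ∷ ℓ ∷ E ∷ a ∷ [])
      (λ iE jE ℓ E a → 1 ∙ 18 ⊗ iE ⊕ 42 ⊗ jE ⊕ con 1 ≼ ℓ & ∅ ⊢
        0 ∙ 18 ⊗ iE ⊕ 42 ⊗ (E ⊕ jE) ⊕ con 1 ≼ ℓ ⊕ (42 ⊗ E ⊕ a)) (p , tt))
  Inv₃-add {t} {bin i j ℓ} a _ (inj₂ (i≡0 , _ , p)) = inj₂ (i≡0 , s≤s z≤n ,
    farkas (j * E ∷ ℓ ∷ E ∷ t ∷ a ∷ [])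
      (λ jE ℓ E t a → 1 ∙ 42 ⊗ jE ⊕ t ≼ ℓ & ∅ ⊢ 0 ∙ 42 ⊗ (E ⊕ jE) ⊕ t ≼ ℓ ⊕ (42 ⊗ E ⊕ a)) (p , tt))

  Inv₃-new : ∀ a → 0 < a → Inv₃ a (bin 0 1 (42 * E + a))
  Inv₃-new a _ = inj₂ (refl , s≤s z≤n ,
    farkas (E ∷ a ∷ []) (λ E a → ∅ ⊢ 0 ∙ 42 ⊗ (E ⊕ con 0) ⊕ a ≼ 42 ⊗ E ⊕ a) tt)

  module P₁ = Phase dec 1 0 (18 * E) E Inv₁
    (λ {t} {u} {b} → Inv₁-mono {t} {u} {b}) (λ {t} {b} → Inv₁-add {t} {b}) Inv₁-new
  module P₃ = Phase dec 0 1 (42 * E) E Inv₃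
    (λ {t} {u} {b} → Inv₃-mono {t} {u} {b}) (λ {t} {b} → Inv₃-add {t} {b}) Inv₃-new

  -- Handover between the phases: of a bin with sevenths it is only kept that its level exceeds the
  -- nominal content.
  Inv₁⇒Inv₃ : ∀ {t u b} → Inv₁ (suc u) b → Inv₃ t b
  Inv₁⇒Inv₃ {t} {u} {bin i .0 ℓ} (1≤i , refl , p) = inj₁ (1≤i ,
    farkas (i * E ∷ ℓ ∷ u ∷ [])
      (λ iE ℓ u → 1 ∙ 18 ⊗ iE ⊕ (con 1 ⊕ u) ≼ ℓ & ∅ ⊢ 0 ∙ 18 ⊗ iE ⊕ con 0 ⊕ con 1 ≼ ℓ) (p , tt))

  module Endings (outcome₁ : P₁.Outcome N 0 [] [])
                 (outcome₃ : P₃.Outcome N 0 (P₁.Outcome.final outcome₁) (P₁.Outcome.items outcome₁)) where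

    open P₁.Outcome outcome₁ renaming
      ( items to I₁; smalls to S₁; larges to L₁; final to bins₁; σ to σ₁; is-run to is-run₁; invariant to invariant₁
      ; partition to partition₁; smalls-≤ to S₁-≤; items-≤ to I₁-≤; positive to I₁-positive; count to count₁
      ; opened to opened₁; σ-< to σ₁-<; additive to additive₁) using ()

    open P₃.Outcome outcome₃ renaming
      ( items to I₃; smalls to S₃; larges to L₃; final to bins₃; σ to σ₃; is-run to is-run₃; invariant to invariant₃
      ; partition to partition₃; smalls-≤ to S₃-≤; items-≤ to I₃-≤; positive to I₃-positive; count to count₃
      ; opened to opened₃; σ-< to σ₃-<; additive to additive₃) using ()

    σ₁≤E : σ₁ ≤ E
    σ₁≤E = ≤-trans (<⇒≤ σ₁-<) 2^N≤E

    σ₃≤E : σ₃ ≤ E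
    σ₃≤E = ≤-trans (<⇒≤ σ₃-<) 2^N≤E

    is-run₁₃ : run dec [] [] (I₁ ++ I₃) ≡ map level bins₃
    is-run₁₃ = trans (run-++ dec [] [] I₁ I₃) (trans (cong (λ ls → run dec ls I₁ I₃) is-run₁) is-run₃)

    X L : ℕ
    X = length bins₁
    L = length L₃

    -- The five endings and their offline packings

    module Ending {I bs} (is-run : run dec [] [] I ≡ map level bs) (I-positive : All (0 <_) I)
                  (y e : ℕ) (D<2e : D < e + e) (fits : Fits D N (I ++ replicate y e)) where

      ended : List ℕ
      ended = run dec (map level bs) I (replicate y e)

      e>0 : 0 < e
      e>0 = n≢0⇒n>0 λ { refl → contradiction D<2e λ () }

      positive : All (0 <_) (I ++ replicate y e)
      positive = Allₚ.++⁺ I-positive (Allₚ.replicate⁺ y e>0)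

      is-ended : run dec [] [] (I ++ replicate y e) ≡ ended
      is-ended = trans (run-++ dec [] [] I (replicate y e)) (cong (λ ls → run dec ls I (replicate y e)) is-run)

      bounded : All (_≤ D) ended
      bounded = subst (All (_≤ D)) is-ended (legal-bounded A N legal positive fits)

      level-≤ : All (λ b → level b ≤ D) bs
      level-≤ = Allₚ.map⁻ (run-bounded dec (map level bs) I (replicate y e) bounded)

      Σ-of-level : ∀ bs → Σ-of (full D e ∘ level) bs ≡ Σ-of (full D e) (map level bs)
      Σ-of-level []       = refl
      Σ-of-level (b ∷ bs) = cong (full D e (level b) +_) (Σ-of-level bs)

      -- By `run-full`, the bins too full for a further ending item number `y` more after the ending
      -- than before it, and they are all among the bins paid for.
      ending : ∀ μ → All (λ b → μ b ≤ full D e (level b)) bs → Forces A N (y + Σ-of μ bs)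
      ending μ blocked =
        let J , valid , opt , cost≥ = forces A N legal positive fits in
        J , valid , opt , (begin
          y + Σ-of μ bs                               ≤⟨ +-monoʳ-≤ y (Σ-of-mono blocked) ⟩
          y + Σ-of (full D e ∘ level) bs              ≡⟨ cong (y +_) (Σ-of-level bs) ⟩
          y + Σ-of (full D e) (map level bs)          ≡⟨ run-full D<2e dec y (map level bs) I bounded ⟨
          Σ-of (full D e) ended                       ≤⟨ Σ-of≤length (full≤1 D e) ended ⟩
          length ended                                ≡⟨ cong length is-ended ⟨
          length (run dec [] [] (I ++ replicate y e)) ≤⟨ cost≥ ⟩
          cost A N J                                  ∎)
        where open ≤-Reasoning

    I₁₃-positive : All (0 <_) (I₁ ++ I₃)
    I₁₃-positive = Allₚ.++⁺ I₁-positive I₃-positive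

    lengths₁ : length S₁ + X ≡ N
    lengths₁ = trans (cong (length S₁ +_) opened₁)
      (trans (sym (length-++ S₁)) (trans (sym (↭-length partition₁)) count₁))

    lengths₃ : length S₃ + L ≡ N
    lengths₃ = trans (sym (length-++ S₃)) (trans (sym (↭-length partition₃)) count₃)

    -- Offline, the small sevenths go with the ending items and the large ones into Z further bins.
    branch-small-seventh : ∀ y Z → y + Z ≡ N → X ≤ Z * 6 → Z ≤ X → Forces A N (y + X)
    branch-small-seventh y Z y+Z≡N X≤6Z Z≤X =
      subst (λ c → Forces A N (y + c)) (Σ-of-one bins₁)
        (Ending.ending is-run₁ I₁-positive y e D<2e fits (λ _ → 1) (All.map (λ {b} → blocked b) invariant₁))
      where
      -- Exactly what the bound `18 * E + σ₁` on small sevenths leaves free in a bin. Every online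
      -- bin was opened by a large seventh and is thus blocked.
      e = 108 * E ∸ σ₁

      e+σ : e + σ₁ ≡ 108 * E
      e+σ = m∸n+n≡m (≤-trans σ₁≤E (m≤m+n E _))

      D<2e : D < e + e
      D<2e = farkas (e ∷ σ₁ ∷ E ∷ [])
        (λ e σ E → 2 ∙ 108 ⊗ E ≼ e ⊕ σ & 2 ∙ σ ≼ E & 88 ∙ con 1 ≼ E & ∅ ⊢
          0 ∙ con 1 ⊕ 126 ⊗ E ≼ e ⊕ e)
        (≤-reflexive (sym e+σ) , σ₁≤E , E>0 , tt)

      smalls-fit : Fits D y (S₁ ++ replicate y e)
      smalls-fit = Fits-weaken
        (farkas (e ∷ σ₁ ∷ E ∷ []) (λ e σ E → 1 ∙ e ⊕ σ ≼ 108 ⊗ E & ∅ ⊢ 0 ∙ 1 ⊗ (18 ⊗ E ⊕ σ) ⊕ e ≼ 126 ⊗ E)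
          (≤-reflexive e+σ , tt))
        (Fits-merge (Fits-uniform 1 y S₁-≤ (≤-trans (+-cancelʳ-≤ X _ _ (begin
            length S₁ + X ≡⟨ lengths₁ ⟩
            N             ≡⟨ y+Z≡N ⟨
            y + Z         ≤⟨ +-monoʳ-≤ y Z≤X ⟩
            y + X         ∎)) (≤-reflexive (sym (*-identityʳ y)))))
          (Fits-replicate y e))
        where open ≤-Reasoning

      larges-fit : Fits D Z L₁
      larges-fit = Fits-weaken
        (farkas (E ∷ []) (λ E → ∅ ⊢ 0 ∙ 6 ⊗ (18 ⊗ E ⊕ E) ≼ 126 ⊗ E) tt)
        (Fits-uniform 6 Z (Allₚ.++⁻ʳ S₁ (All-resp-↭ partition₁ I₁-≤))
          (≤-trans (≤-reflexive (sym opened₁)) X≤6Z))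

      fits : Fits D N (I₁ ++ replicate y e)
      fits = subst (λ k → Fits D k (I₁ ++ replicate y e)) y+Z≡N (Fits-resp-↭
        (↭-trans (↭-reflexive (++-assoc S₁ (replicate y e) L₁))
          (↭-trans (++⁺ˡ S₁ (++-comm (replicate y e) L₁))
            (↭-trans (↭-reflexive (sym (++-assoc S₁ L₁ _))) (++⁺ʳ (replicate y e) (↭-sym partition₁)))))
        (Fits-union smalls-fit larges-fit))

      blocked : ∀ b → Inv₁ (suc σ₁) b → 1 ≤ full D e (level b)
      blocked (bin (suc i) j ℓ) (_ , _ , p) = full-one {D} e ℓ ≤-refl
        (farkas (ℓ ∷ e ∷ σ₁ ∷ E ∷ i * E ∷ [])
          (λ ℓ e σ E iE → 1 ∙ 18 ⊗ (E ⊕ iE) ⊕ (con 1 ⊕ σ) ≼ ℓ & 1 ∙ 108 ⊗ E ≼ e ⊕ σ & ∅ ⊢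
            0 ∙ con 1 ⊕ 126 ⊗ E ≼ ℓ ⊕ e)
          (p , ≤-reflexive (sym e+σ) , tt))

    -- Offline, each ending item shares a bin with one seventh. One seventh takes at most `19 * E`
    -- and two take more than `36 * E`, so `105 * E` fits beside one only.
    branch-seventh : Forces A N (N + Σ-of (atLeast2 ∘ sevenths) bins₁)
    branch-seventh = Ending.ending is-run₁ I₁-positive N e D<2e fits (atLeast2 ∘ sevenths)
      (All.map (λ {b} → blocked b) invariant₁)
      where
      e = 105 * E

      D<2e : D < e + e
      D<2e = farkas (E ∷ []) (λ E → 1 ∙ con 1 ≼ E & ∅ ⊢ 0 ∙ con 1 ⊕ 126 ⊗ E ≼ 105 ⊗ E ⊕ 105 ⊗ E) (E>0 , tt)

      fits : Fits D N (I₁ ++ replicate N e)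
      fits = Fits-weaken (farkas (E ∷ []) (λ E → ∅ ⊢ 0 ∙ 1 ⊗ (18 ⊗ E ⊕ E) ⊕ 105 ⊗ E ≼ 126 ⊗ E) tt)
        (Fits-merge (Fits-uniform 1 N I₁-≤ (≤-reflexive (trans count₁ (sym (*-identityʳ N))))) (Fits-replicate N e))

      blocked : ∀ b → Inv₁ (suc σ₁) b → atLeast2 (sevenths b) ≤ full D e (level b)
      blocked (bin 0 j ℓ) _ = z≤n
      blocked (bin 1 j ℓ) _ = z≤n
      blocked (bin (suc (suc i)) j ℓ) (_ , _ , p) = full-one {D} e ℓ ≤-refl
        (farkas (ℓ ∷ σ₁ ∷ E ∷ i * E ∷ [])
          (λ ℓ σ E iE → 1 ∙ 18 ⊗ (E ⊕ (E ⊕ iE)) ⊕ (con 1 ⊕ σ) ≼ ℓ & ∅ ⊢ 0 ∙ con 1 ⊕ 126 ⊗ E ≼ ℓ ⊕ 105 ⊗ E)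
          (p , tt))

    -- Offline, every bin takes one seventh, one third and one ending item. The legality of this run
    -- also bounds the final bins and yields `content-bound`.
    module Half where
      e = 63 * E + 1

      D<2e : D < e + e
      D<2e = farkas (E ∷ []) (λ E → ∅ ⊢ 0 ∙ con 1 ⊕ 126 ⊗ E ≼ 63 ⊗ E ⊕ con 1 ⊕ (63 ⊗ E ⊕ con 1)) tt

      fits : Fits D N ((I₁ ++ I₃) ++ replicate N e)
      fits = Fits-weaken
        (farkas (E ∷ []) (λ E → 1 ∙ con 1 ≼ E & ∅ ⊢
          0 ∙ 1 ⊗ (18 ⊗ E ⊕ E) ⊕ 1 ⊗ (42 ⊗ E ⊕ E) ⊕ (63 ⊗ E ⊕ con 1) ≼ 126 ⊗ E) (E>0 , tt))
        (Fits-merge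
          (Fits-merge (Fits-uniform 1 N I₁-≤ (≤-reflexive (trans count₁ (sym (*-identityʳ N)))))
                      (Fits-uniform 1 N I₃-≤ (≤-reflexive (trans count₃ (sym (*-identityʳ N))))))
          (Fits-replicate N e))

      open Ending is-run₁₃ I₁₃-positive N e D<2e fits public

      weight : Bin → ℕ
      weight b = noHalf (sevenths b) (thirds b)

      -- Offsets are positive, so the level strictly exceeds the nominal content; the strictness is
      -- what excludes a content of exactly 42.
      content-<-level : ∀ {t b} → Inv₃ (suc t) b → 3 * ((6 * sevenths b + 14 * thirds b) * E) < level b
      content-<-level {t} {bin i j ℓ} inv =
        ≤-trans (≤-reflexive (cong (λ c → suc (3 * c)) (scaled E i j))) (scaled-bound inv)
        where
        scaled-bound : Inv₃ (suc t) (bin i j ℓ) → 3 * (6 * (i * E) + 14 * (j * E)) < ℓ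
        scaled-bound (inj₁ (_ , p)) = farkas (i * E ∷ j * E ∷ ℓ ∷ [])
          (λ iE jE ℓ → 1 ∙ 18 ⊗ iE ⊕ 42 ⊗ jE ⊕ con 1 ≼ ℓ & ∅ ⊢ 0 ∙ con 1 ⊕ 3 ⊗ (6 ⊗ iE ⊕ 14 ⊗ jE) ≼ ℓ) (p , tt)
        scaled-bound (inj₂ (refl , _ , p)) = farkas (j * E ∷ ℓ ∷ t ∷ [])
          (λ jE ℓ t → 1 ∙ 42 ⊗ jE ⊕ (con 1 ⊕ t) ≼ ℓ & ∅ ⊢ 0 ∙ con 1 ⊕ 3 ⊗ (con 0 ⊕ 14 ⊗ jE) ≼ ℓ) (p , tt)

      blocked : ∀ b → Inv₃ (suc σ₃) b → weight b ≤ full D e (level b)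
      blocked (bin i j ℓ) inv = noHalf-≤ i j λ heavy → full-one {D} e ℓ ≤-refl
        (farkas ((6 * i + 14 * j) * E ∷ ℓ ∷ E ∷ [])
          (λ c ℓ E → 3 ∙ 21 ⊗ E ≼ c & 1 ∙ con 1 ⊕ 3 ⊗ c ≼ ℓ & ∅ ⊢ 0 ∙ con 1 ⊕ 126 ⊗ E ≼ ℓ ⊕ (63 ⊗ E ⊕ con 1))
          (*-monoˡ-≤ E heavy , content-<-level {σ₃} {bin i j ℓ} inv , tt))

      branch : Forces A N (N + Σ-of weight bins₃)
      branch = ending weight (All.map (λ {b} → blocked b) invariant₃)

      content-bound : All (λ b → 6 * sevenths b + 14 * thirds b < 42) bins₃
      content-bound = All.zipWith (λ {b} (inv , ℓ≤D) → bound b inv ℓ≤D) (invariant₃ , level-≤)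
        where
        bound : ∀ b → Inv₃ (suc σ₃) b → level b ≤ D → 6 * sevenths b + 14 * thirds b < 42
        bound b inv ℓ≤D = *-cancelʳ-< E _ 42 (*-cancelˡ-< 3 _ (42 * E)
          (≤-trans (content-<-level {σ₃} {b} inv) (≤-trans ℓ≤D
            (farkas (E ∷ []) (λ E → ∅ ⊢ 0 ∙ 126 ⊗ E ≼ 3 ⊗ (42 ⊗ E)) tt))))

    -- Offline, Z bins hold two thirds and two sevenths, Z bins an ending item and two sevenths, and
    -- y bins an ending item and a small third.
    branch-small-third : ∀ Z y → (Z + Z) + y ≡ N → L ≤ Z * 2 → N ≤ (Z + Z) * 2 →
      Forces A N (Z + y + Σ-of (λ b → noTwoThirds (sevenths b) (thirds b)) bins₃)
    branch-small-third Z y 2Z+y≡N L≤2Z N≤4Z = Ending.ending is-run₁₃ I₁₃-positive (Z + y) e D<2e fits _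
      (All.map (λ {b} → blocked b) invariant₃)
      where
      e = 84 * E ∸ σ₃

      e+σ : e + σ₃ ≡ 84 * E
      e+σ = m∸n+n≡m (≤-trans σ₃≤E (m≤m+n E _))

      D<2e : D < e + e
      D<2e = farkas (e ∷ σ₃ ∷ E ∷ [])
        (λ e σ E → 2 ∙ 84 ⊗ E ≼ e ⊕ σ & 2 ∙ σ ≼ E & 40 ∙ con 1 ≼ E & ∅ ⊢
          0 ∙ con 1 ⊕ 126 ⊗ E ≼ e ⊕ e)
        (≤-reflexive (sym e+σ) , σ₃≤E , E>0 , tt)

      -- The places in the `Z` pairs of thirds not taken by large ones go to `k` small thirds, which
      -- leaves at most `y` small thirds.
      k : ℕ
      k = Z * 2 ∸ L

      paired alone : List ℕ
      paired = L₃ ++ take k S₃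
      alone  = drop k S₃

      partition : I₃ ↭ paired ++ alone
      partition = ↭-trans partition₃ (↭-trans (++-comm S₃ L₃)
        (↭-reflexive (trans (cong (L₃ ++_) (sym (take++drop≡id k S₃))) (sym (++-assoc L₃ (take k S₃) alone)))))

      paired-length : length paired ≤ Z * 2
      paired-length = ≤-trans (≤-reflexive (length-++ L₃)) (≤-trans
        (+-monoʳ-≤ L (≤-trans (≤-reflexive (length-take k S₃)) (m⊓n≤m k _)))
        (≤-reflexive (m+[n∸m]≡n L≤2Z)))

      alone-length : length alone ≤ y
      alone-length = ≤-trans (≤-reflexive (length-drop k S₃)) (m≤n+o⇒m∸n≤o _ k
        (farkas (k ∷ length S₃ ∷ L ∷ Z ∷ y ∷ N ∷ [])
          (λ k s L Z y N → 1 ∙ s ⊕ L ≼ N & 1 ∙ N ≼ (Z ⊕ Z) ⊕ y & 1 ∙ Z ⊕ Z ≼ L ⊕ k & ∅ ⊢ 0 ∙ s ≼ k ⊕ y)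
          (≤-reflexive lengths₃ , ≤-reflexive (sym 2Z+y≡N) ,
           ≤-reflexive (trans (sym (trans (*-comm Z 2) (cong (Z +_) (+-identityʳ Z))))
                              (sym (m+[n∸m]≡n L≤2Z))) , tt)))

      -- `86 * E` covers two thirds as well as one ending item; the other `40 * E` of each bin take
      -- two sevenths.
      paired-fit : Fits (86 * E) (Z + Z) (paired ++ replicate Z e)
      paired-fit = Fits-union
        (Fits-weaken (farkas (E ∷ []) (λ E → ∅ ⊢ 0 ∙ 2 ⊗ (42 ⊗ E ⊕ E) ≼ 86 ⊗ E) tt)
          (Fits-uniform 2 Z (Allₚ.++⁻ˡ paired (All-resp-↭ partition I₃-≤)) paired-length))
        (Fits-weaken (≤-trans (m∸n≤m (84 * E) σ₃) (*-monoˡ-≤ E (≤ᵇ⇒≤ 84 86 tt))) (Fits-replicate Z e))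

      alone-fit : Fits D y (alone ++ replicate y e)
      alone-fit = Fits-weaken
        (farkas (e ∷ σ₃ ∷ E ∷ []) (λ e σ E → 1 ∙ e ⊕ σ ≼ 84 ⊗ E & ∅ ⊢ 0 ∙ 1 ⊗ (42 ⊗ E ⊕ σ) ⊕ e ≼ 126 ⊗ E)
          (≤-reflexive e+σ , tt))
        (Fits-merge (Fits-uniform 1 y (Allₚ.drop⁺ k S₃-≤) (≤-trans alone-length (≤-reflexive (sym (*-identityʳ y)))))
                    (Fits-replicate y e))

      first-fit : Fits D (Z + Z) (I₁ ++ paired ++ replicate Z e)
      first-fit = Fits-weaken (farkas (E ∷ []) (λ E → ∅ ⊢ 0 ∙ 2 ⊗ (18 ⊗ E ⊕ E) ⊕ 86 ⊗ E ≼ 126 ⊗ E) tt)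
        (Fits-merge (Fits-uniform 2 (Z + Z) I₁-≤ (≤-trans (≤-reflexive count₁) N≤4Z)) paired-fit)

      replicate-+ : ∀ m n → replicate m e ++ replicate n e ≡ replicate (m + n) e
      replicate-+ zero    n = refl
      replicate-+ (suc m) n = cong (e ∷_) (replicate-+ m n)

      rearrange : ∀ (P Q R S T : List ℕ) → (P ++ Q ++ R) ++ (S ++ T) ↭ (P ++ Q ++ S) ++ (R ++ T)
      rearrange P Q R S T = begin
        (P ++ Q ++ R) ++ (S ++ T) ≡⟨ ++-assoc P (Q ++ R) (S ++ T) ⟩
        P ++ (Q ++ R) ++ (S ++ T) ≡⟨ cong (P ++_) (++-assoc Q R (S ++ T)) ⟩
        P ++ Q ++ R ++ S ++ T     ↭⟨ ++⁺ˡ P (++⁺ˡ Q (shifts R S)) ⟩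
        P ++ Q ++ S ++ R ++ T     ≡⟨ cong (P ++_) (++-assoc Q S (R ++ T)) ⟨
        P ++ (Q ++ S) ++ R ++ T   ≡⟨ ++-assoc P (Q ++ S) (R ++ T) ⟨
        (P ++ Q ++ S) ++ (R ++ T) ∎
        where open PermutationReasoning

      fits : Fits D N ((I₁ ++ I₃) ++ replicate (Z + y) e)
      fits = subst (λ n → Fits D n ((I₁ ++ I₃) ++ replicate (Z + y) e)) 2Z+y≡N (Fits-resp-↭
        (↭-trans (rearrange I₁ paired (replicate Z e) alone (replicate y e))
          (++⁺ (++⁺ˡ I₁ (↭-sym partition)) (↭-reflexive (replicate-+ Z y))))
        (Fits-union first-fit alone-fit))

      blocked : ∀ b → Inv₃ (suc σ₃) b → noTwoThirds (sevenths b) (thirds b) ≤ full D e (level b)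
      blocked (bin 0 zero ℓ)    _                    = z≤n
      -- A bin without sevenths was opened by a large third, which is just too large for `e`.
      blocked (bin 0 (suc j) ℓ) (inj₂ (_ , _ , p))   = full-one {D} e ℓ ≤-refl
        (farkas (ℓ ∷ e ∷ σ₃ ∷ E ∷ j * E ∷ [])
          (λ ℓ e σ E jE → 1 ∙ 42 ⊗ (E ⊕ jE) ⊕ (con 1 ⊕ σ) ≼ ℓ & 1 ∙ 84 ⊗ E ≼ e ⊕ σ & ∅ ⊢
            0 ∙ con 1 ⊕ 126 ⊗ E ≼ ℓ ⊕ e)
          (p , ≤-reflexive (sym e+σ) , tt))
      blocked (bin 1 zero ℓ)    _                    = z≤n
      blocked (bin 2 zero ℓ)    _                    = z≤n
      blocked (bin (suc (suc (suc i))) zero ℓ) (inj₁ (_ , p)) = full-one {D} e ℓ ≤-refl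
        (farkas (ℓ ∷ e ∷ σ₃ ∷ E ∷ i * E ∷ [])
          (λ ℓ e σ E iE →
            1 ∙ 18 ⊗ (E ⊕ (E ⊕ (E ⊕ iE))) ⊕ con 0 ⊕ con 1 ≼ ℓ & 1 ∙ 84 ⊗ E ≼ e ⊕ σ & 1 ∙ σ ≼ E & ∅ ⊢
            0 ∙ con 1 ⊕ 126 ⊗ E ≼ ℓ ⊕ e)
          (p , ≤-reflexive (sym e+σ) , σ₃≤E , tt))
      blocked (bin (suc i) (suc j) ℓ) (inj₁ (_ , p)) = full-one {D} e ℓ (noTwoThirds≤1 (suc i) (suc j))
        (farkas (ℓ ∷ e ∷ σ₃ ∷ E ∷ i * E ∷ j * E ∷ [])
          (λ ℓ e σ E iE jE →
            1 ∙ 18 ⊗ (E ⊕ iE) ⊕ 42 ⊗ (E ⊕ jE) ⊕ con 1 ≼ ℓ & 1 ∙ 84 ⊗ E ≼ e ⊕ σ & 1 ∙ σ ≼ E & ∅ ⊢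
            0 ∙ con 1 ⊕ 126 ⊗ E ≼ ℓ ⊕ e)
          (p , ≤-reflexive (sym e+σ) , σ₃≤E , tt))
        where
        noTwoThirds≤1 : ∀ i j → noTwoThirds i j ≤ 1
        noTwoThirds≤1 0 0 = z≤n
        noTwoThirds≤1 0 (suc _) = ≤-refl
        noTwoThirds≤1 1 0 = z≤n
        noTwoThirds≤1 1 (suc _) = ≤-refl
        noTwoThirds≤1 2 0 = z≤n
        noTwoThirds≤1 2 (suc _) = ≤-refl
        noTwoThirds≤1 (suc (suc (suc _))) _ = ≤-refl

    -- An item filling a whole bin fits into no bin already open. Offline, half of the bins hold two
    -- sevenths and two thirds each, the other half the ending items.
    branch-unit : Forces A N (2 * h + length bins₃)
    branch-unit = subst (λ c → Forces A N (2 * h + c)) (Σ-of-one bins₃)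
      (Ending.ending is-run₁₃ I₁₃-positive (2 * h) D D<2D fits (λ _ → 1) (All.map (λ {b} → blocked b) invariant₃))
      where
      D<2D : D < D + D
      D<2D = m<m+n D D>0

      half : length I₁ ≡ 2 * h * 2 × length I₃ ≡ 2 * h * 2
      half = trans count₁ eq , trans count₃ eq
        where
        eq : 4 * h ≡ 2 * h * 2
        eq = trans (*-assoc 2 2 h) (*-comm 2 (2 * h))

      fits : Fits D N ((I₁ ++ I₃) ++ replicate (2 * h) D)
      fits = subst (λ n → Fits D n ((I₁ ++ I₃) ++ replicate (2 * h) D)) (sym (*-distribʳ-+ h 2 2))
        (Fits-union
          (Fits-weaken (farkas (E ∷ []) (λ E → ∅ ⊢ 0 ∙ 2 ⊗ (18 ⊗ E ⊕ E) ⊕ 2 ⊗ (42 ⊗ E ⊕ E) ≼ 126 ⊗ E) tt)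
            (Fits-merge (Fits-uniform 2 (2 * h) I₁-≤ (≤-reflexive (proj₁ half)))
                        (Fits-uniform 2 (2 * h) I₃-≤ (≤-reflexive (proj₂ half)))))
          (Fits-replicate (2 * h) D))

      blocked : ∀ b → Inv₃ (suc σ₃) b → 1 ≤ full D D (level b)
      blocked (bin i j ℓ) (inj₁ (_ , p)) = full-one {D} D ℓ ≤-refl
        (farkas (ℓ ∷ i * E ∷ j * E ∷ E ∷ []) (λ ℓ iE jE E → 1 ∙ 18 ⊗ iE ⊕ 42 ⊗ jE ⊕ con 1 ≼ ℓ & ∅ ⊢
          0 ∙ con 1 ⊕ 126 ⊗ E ≼ ℓ ⊕ 126 ⊗ E) (p , tt))
      blocked (bin i j ℓ) (inj₂ (_ , _ , p)) = full-one {D} D ℓ ≤-refl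
        (farkas (ℓ ∷ j * E ∷ E ∷ σ₃ ∷ []) (λ ℓ jE E σ → 1 ∙ 42 ⊗ jE ⊕ (con 1 ⊕ σ) ≼ ℓ & ∅ ⊢
          0 ∙ con 1 ⊕ 126 ⊗ E ≼ ℓ ⊕ 126 ⊗ E) (p , tt))

    -- Combining the endings by linear programming duality

    Σ-sevenths₁ : Σ-of sevenths bins₁ ≡ N
    Σ-sevenths₁ = trans (additive₁ sevenths 1 (λ _ _ → refl) refl) (trans (+-identityʳ (N * 1)) (*-identityʳ N))

    preserved : ∀ (μ : ℕ → ℕ) → μ 0 ≡ 0 → Σ-of (μ ∘ sevenths) bins₃ ≡ Σ-of (μ ∘ sevenths) bins₁
    preserved μ base = trans (additive₃ (μ ∘ sevenths) 0 (λ _ _ → refl) base)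
      (cong (_+ Σ-of (μ ∘ sevenths) bins₁) (*-zeroʳ N))

    Σ-sevenths₃ : Σ-of sevenths bins₃ ≡ N
    Σ-sevenths₃ = trans (preserved (λ i → i) refl) Σ-sevenths₁

    Σ-thirds₃ : Σ-of thirds bins₃ ≡ N
    Σ-thirds₃ = trans (additive₃ thirds 1 (λ _ _ → refl) refl) (trans
      (cong₂ _+_ (*-identityʳ N)
        (trans (additive₁ thirds 0 (λ _ _ → refl) refl) (trans (+-identityʳ (N * 0)) (*-zeroʳ N))))
      (+-identityʳ N))

    X>0 : 0 < X
    X>0 = n≢0⇒n>0 λ X≡0 → contradiction
      (trans (sym (Σ-of-empty sevenths bins₁ X≡0)) Σ-sevenths₁) (<⇒≢ (≤-trans h>0 (m≤m+n h _)))

    x₂ H K : ℕ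
    x₂ = Σ-of (atLeast2 ∘ sevenths) bins₁
    H = Σ-of (λ b → noHalf (sevenths b) (thirds b)) bins₃
    K = Σ-of (λ b → noTwoThirds (sevenths b) (thirds b)) bins₃

    -- The left side is the total price of all sevenths and thirds; `dual-feasible` is summed over
    -- the final bins.
    dual : N + 2 * N ≤ 2 * H + 2 * K + x₂ + X
    dual = begin
      N + 2 * N                                              ≡⟨ cong₂ (λ i j → i + 2 * j) Σ-sevenths₃ Σ-thirds₃ ⟨
      Σ-of sevenths bins₃ + 2 * Σ-of thirds bins₃            ≤⟨ Σ-dual Half.content-bound ⟩
      2 * H + 2 * K + Σ-of (atLeast2 ∘ sevenths) bins₃ + Σ-of (atLeast1 ∘ sevenths) bins₃
        ≡⟨ cong₂ (λ u v → 2 * H + 2 * K + u + v) (preserved atLeast2 refl) (preserved atLeast1 refl) ⟩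
      2 * H + 2 * K + x₂ + Σ-of (atLeast1 ∘ sevenths) bins₁  ≤⟨ +-monoʳ-≤ (2 * H + 2 * K + x₂)
                                                                  (Σ-of≤length (λ b → atLeast1≤1 (sevenths b)) bins₁) ⟩
      2 * H + 2 * K + x₂ + X                                 ∎
      where
      open ≤-Reasoning
      atLeast1≤1 : ∀ i → atLeast1 i ≤ 1
      atLeast1≤1 zero    = z≤n
      atLeast1≤1 (suc _) = ≤-refl

    Result : Set
    Result = Σ ℕ λ c → Forces A N c × 87 * N ≤ 62 * c + 12

    -- Either this ending is already expensive enough, or its failure is handed on as a premise for
    -- the final contradiction.
    attempt : ∀ {c} → Forces A N c → (62 * c + 13 ≤ 87 * N → Result) → Result
    attempt {c} forced otherwise = case (≤-<-connex (87 * N) (62 * c + 12))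
      where
      case : 87 * N ≤ 62 * c + 12 ⊎ 62 * c + 12 < 87 * N → Result
      case (inj₁ p) = c , forced , p
      case (inj₂ p) = otherwise (≤-trans (≤-reflexive (+-suc (62 * c) 12)) p)

    -- The endings have weights 6 : 5 : 10 : 10, the dual solution of the linear program. They give the
    -- bound 62 c ≥ 87 N - 12 for the largest cost c.
    few-large-thirds : L ≤ 2 * h → Result
    few-large-thirds L≤2h =
      attempt (branch-small-seventh y Z y+Z≡N X≤6Z Z≤X) λ a →
      attempt branch-seventh λ b →
      attempt Half.branch λ c →
      -- `Z = h` is large enough: `2 * h` bins take all sevenths in pairs, and `h` bins take all
      -- large thirds in pairs.
      attempt (branch-small-third h (2 * h)
                (sym (trans (*-distribʳ-+ h 2 2) (cong (_+ 2 * h) (cong (h +_) (+-identityʳ h)))))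
                (≤-trans L≤2h (≤-reflexive (*-comm 2 h)))
                (≤-reflexive (trans (*-distribʳ-+ h 2 2)
                                    (trans (sym (*-distribˡ-+ 2 h h)) (*-comm 2 (h + h)))))) λ d →
      contradiction
        -- Since `6 * Z ≤ X + 6`, the first ending with weight 6 still yields 5 X beyond 6 N - 6, so
        -- the bin counts add up to five times the right side of `dual`.
        (farkas (h ∷ X ∷ Z ∷ y ∷ x₂ ∷ H ∷ K ∷ [])
          (λ h X Z y x₂ H K →
            6 ∙ 62 ⊗ (y ⊕ X) ⊕ con 13 ≼ 87 ⊗ (4 ⊗ h) &
            5 ∙ 62 ⊗ (4 ⊗ h ⊕ x₂) ⊕ con 13 ≼ 87 ⊗ (4 ⊗ h) &
            10 ∙ 62 ⊗ (4 ⊗ h ⊕ H) ⊕ con 13 ≼ 87 ⊗ (4 ⊗ h) &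
            10 ∙ 62 ⊗ (h ⊕ 2 ⊗ h ⊕ K) ⊕ con 13 ≼ 87 ⊗ (4 ⊗ h) &
            372 ∙ 4 ⊗ h ≼ y ⊕ Z &
            62 ∙ 6 ⊗ Z ≼ X ⊕ con 6 &
            310 ∙ 4 ⊗ h ⊕ 2 ⊗ (4 ⊗ h) ≼ 2 ⊗ H ⊕ 2 ⊗ K ⊕ x₂ ⊕ X & ∅ ⊢
            0 ∙ con 1 ≼ con 0)
          (a , b , c , d , ≤-reflexive (sym y+Z≡N) , 6Z≤X+6 , dual , tt))
        λ ()
      where
      -- Rounding up past X / 6 costs at most one bin and is the source of the constant 6 in
      -- `6Z≤X+6`.
      Z : ℕ
      Z = suc (X / 6)

      X≤6Z : X ≤ Z * 6
      X≤6Z = ≤-trans (≤-reflexive (m≡m%n+[m/n]*n X 6)) (+-monoˡ-≤ (X / 6 * 6) (<⇒≤ (m%n<n X 6)))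

      6Z≤X+6 : 6 * Z ≤ X + 6
      6Z≤X+6 = ≤-trans (≤-reflexive (trans (*-comm 6 Z) (+-comm 6 (X / 6 * 6)))) (+-monoˡ-≤ 6 (m/n*n≤m X 6))

      Z≤X : Z ≤ X
      Z≤X = ≤-pred (*-cancelˡ-< 6 Z (suc X) (farkas (X ∷ Z ∷ [])
        (λ X Z → 1 ∙ 6 ⊗ Z ≼ X ⊕ con 6 & 5 ∙ con 1 ≼ X & ∅ ⊢ 0 ∙ con 1 ⊕ 6 ⊗ Z ≼ 6 ⊗ (con 1 ⊕ X))
        (6Z≤X+6 , X>0 , tt)))

      y : ℕ
      y = N ∸ Z

      y+Z≡N : y + Z ≡ N
      y+Z≡N = m∸n+n≡m (≤-trans Z≤X (≤-trans (m≤n+m X (length S₁)) (≤-reflexive lengths₁)))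

    -- Here the weights 1 : 2 : 2 : 1 give the better bound 12 c ≥ 17 N - 2.
    many-large-thirds : 2 * h ≤ L → Result
    many-large-thirds 2h≤L =
      attempt branch-seventh λ b →
      attempt Half.branch λ c →
      attempt (branch-small-third Z y 2Z+y≡N L≤2Z N≤4Z) λ d →
      attempt branch-unit λ e →
      contradiction
        -- `L` cancels: the third ending, counted twice, loses at most `L + 1` ending items, while
        -- the last one gains the `L` bins opened by thirds.
        (farkas (h ∷ X ∷ L ∷ Z ∷ y ∷ x₂ ∷ H ∷ K ∷ length bins₃ ∷ [])
          (λ h X L Z y x₂ H K n →
            1 ∙ 62 ⊗ (4 ⊗ h ⊕ x₂) ⊕ con 13 ≼ 87 ⊗ (4 ⊗ h) &
            2 ∙ 62 ⊗ (4 ⊗ h ⊕ H) ⊕ con 13 ≼ 87 ⊗ (4 ⊗ h) &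
            2 ∙ 62 ⊗ (Z ⊕ y ⊕ K) ⊕ con 13 ≼ 87 ⊗ (4 ⊗ h) &
            1 ∙ 62 ⊗ (2 ⊗ h ⊕ n) ⊕ con 13 ≼ 87 ⊗ (4 ⊗ h) &
            124 ∙ 4 ⊗ h ≼ Z ⊕ Z ⊕ y &
            62 ∙ 2 ⊗ Z ≼ con 1 ⊕ L &
            62 ∙ X ⊕ L ≼ n &
            62 ∙ 4 ⊗ h ⊕ 2 ⊗ (4 ⊗ h) ≼ 2 ⊗ H ⊕ 2 ⊗ K ⊕ x₂ ⊕ X & ∅ ⊢
            0 ∙ con 1 ≼ con 0)
          (b , c , d , e , ≤-reflexive (sym 2Z+y≡N) , ≤-trans (≤-reflexive (*-comm 2 Z)) 2Z≤L+1 ,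
           ≤-reflexive (sym opened₃) , dual , tt))
        λ ()
      where
      -- The exact ceiling of L / 2: for `L = N` a larger value would make `Z + Z` exceed `N`.
      Z : ℕ
      Z = suc L / 2

      2Z≤L+1 : Z * 2 ≤ suc L
      2Z≤L+1 = m/n*n≤m (suc L) 2

      L≤2Z : L ≤ Z * 2
      L≤2Z = ≤-pred (≤-trans (≤-reflexive (m≡m%n+[m/n]*n (suc L) 2)) (+-monoˡ-≤ (Z * 2) (≤-pred (m%n<n (suc L) 2))))

      Z≤2h : Z ≤ 2 * h
      Z≤2h = ≤-pred (*-cancelʳ-< 2 Z (suc (2 * h)) (≤-<-trans 2Z≤L+1 (s≤s (s≤s
        (≤-trans (≤-trans (m≤n+m L (length S₃)) (≤-reflexive lengths₃))
                 (≤-reflexive (trans (*-assoc 2 2 h) (*-comm 2 (2 * h)))))))))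

      y : ℕ
      y = N ∸ (Z + Z)

      2Z+y≡N : Z + Z + y ≡ N
      2Z+y≡N = m+[n∸m]≡n (≤-trans (+-mono-≤ Z≤2h Z≤2h) (≤-reflexive (sym (*-distribʳ-+ h 2 2))))

      N≤4Z : N ≤ (Z + Z) * 2
      N≤4Z = ≤-trans (≤-reflexive (*-distribʳ-+ h 2 2)) (≤-trans (+-mono-≤ (≤-trans 2h≤L L≤2Z) (≤-trans 2h≤L L≤2Z))
        (≤-reflexive (sym (*-distribʳ-+ 2 Z Z))))

    result : Result
    result with ≤-total L (2 * h)
    ... | inj₁ L≤2h = few-large-thirds L≤2h
    ... | inj₂ 2h≤L = many-large-thirds 2h≤L

  outcome₁ : P₁.Outcome N 0 [] []
  outcome₁ = P₁.phase N 0 [] [] 2^N≤E []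

  outcome₃ : P₃.Outcome N 0 (P₁.Outcome.final outcome₁) (P₁.Outcome.items outcome₁)
  outcome₃ = P₃.phase N 0 (P₁.Outcome.final outcome₁) (P₁.Outcome.items outcome₁) 2^N≤E 
    (All.map (λ {b} → Inv₁⇒Inv₃ {2 ^ N} {P₁.Outcome.σ outcome₁} {b}) (P₁.Outcome.invariant outcome₁))


  forced : Σ ℕ λ c → Forces A N c × 87 * N ≤ 62 * c + 12
  forced = Endings.result outcome₁ outcome₃

-- Passage to the asymptotic ratio

ℕ→ℚ-* : ∀ m n → ℕ→ℚ (m * n) ≡ ℕ→ℚ m ℚ.* ℕ→ℚ n
ℕ→ℚ-* zero    n = sym (ℚₚ.*-zeroˡ (ℕ→ℚ n))
ℕ→ℚ-* (suc m) n = begin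
  ℕ→ℚ (n + m * n)                      ≡⟨ ℕ→ℚ-+ n (m * n) ⟩
  ℕ→ℚ n ℚ.+ ℕ→ℚ (m * n)                ≡⟨ cong₂ ℚ._+_ (sym (ℚₚ.*-identityˡ (ℕ→ℚ n))) (ℕ→ℚ-* m n) ⟩
  1ℚ ℚ.* ℕ→ℚ n ℚ.+ ℕ→ℚ m ℚ.* ℕ→ℚ n     ≡⟨ ℚₚ.*-distribʳ-+ (ℕ→ℚ n) 1ℚ (ℕ→ℚ m) ⟨
  (1ℚ ℚ.+ ℕ→ℚ m) ℚ.* ℕ→ℚ n             ≡⟨ cong (ℚ._* ℕ→ℚ n) (ℕ→ℚ-+ 1 m) ⟨
  ℕ→ℚ (suc m) ℚ.* ℕ→ℚ n                ∎ where open ≡-Reasoning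

-- A positive rational is at least the reciprocal of its denominator.
archimedean : ∀ ε → 0ℚ ℚ.< ε → ∀ n → ↧ₙ ε < n → 1ℚ ℚ.< ε ℚ.* ℕ→ℚ n
archimedean (mkℚ (ℤ.+ 0)        d-1 _) 0<ε n d<n = contradiction (ℚ.positive 0<ε) λ ()
archimedean (mkℚ ℤ.-[1+ _ ]   d-1 _) 0<ε n d<n = contradiction (ℚ.positive 0<ε) λ ()
archimedean ε@(mkℚ ℤ.+[1+ p ] d-1 _) 0<ε n d<n = ℚₚ.toℚᵘ-cancel-< (begin-strict
  ℚᵘ.1ℚᵘ                          <⟨ ℚᵘ.*<* numerators ⟩
  toℚᵘ ε ℚᵘ.* ℚᵘ.mkℚᵘ (ℤ.+ n) 0      ≃⟨ ℚᵘₚ.*-congˡ {toℚᵘ ε} (toℚᵘ-ℕ→ℚ n) ⟨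
  toℚᵘ ε ℚᵘ.* toℚᵘ (ℕ→ℚ n)         ≃⟨ ℚₚ.toℚᵘ-homo-* ε (ℕ→ℚ n) ⟨
  toℚᵘ (ε ℚ.* ℕ→ℚ n)              ∎)
  where
  open ℚᵘₚ.≤-Reasoning
  numerators : ℚᵘ.↥ ℚᵘ.1ℚᵘ ℤ.* ℚᵘ.↧ (toℚᵘ ε ℚᵘ.* ℚᵘ.mkℚᵘ (ℤ.+ n) 0) ℤ.<
               ℚᵘ.↥ (toℚᵘ ε ℚᵘ.* ℚᵘ.mkℚᵘ (ℤ.+ n) 0) ℤ.* ℚᵘ.↧ ℚᵘ.1ℚᵘ
  numerators = subst₂ ℤ._<_
    (cong (λ d → ℤ.+ suc d) (sym (trans (+-identityʳ (d-1 * 1)) (*-identityʳ d-1))))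
    (trans (ℤₚ.pos-* (suc p) n) (sym (ℤₚ.*-identityʳ (ℤ.+ suc p ℤ.* ℤ.+ n))))
    (ℤ.+<+ (≤-trans d<n (m≤m+n n (p * n))))

-- The additive loss of 12/62 is below 1, whereas ε times `Q` exceeds 1.
below-ratio : ∀ ε → 0ℚ ℚ.< ε → ∀ Q c → ↧ₙ ε < Q → 87 * Q ≤ 62 * c + 12 →
  ((ℤ.+ 87) ℚ./ 62 ℚ.- ε) ℚ.* ℕ→ℚ Q ℚ.< ℕ→ℚ c
below-ratio ε 0<ε Q c d<Q 87Q≤62c+12 = begin-strict
  (q ℚ.- ε) ℚ.* r             ≡⟨ ℚₚ.*-distribʳ-+ r q (ℚ.- ε) ⟩
  q ℚ.* r ℚ.+ (ℚ.- ε) ℚ.* r   ≡⟨ cong (q ℚ.* r ℚ.+_) (ℚₚ.neg-distribˡ-* ε r) ⟨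
  q ℚ.* r ℚ.- ε ℚ.* r         <⟨ ℚₚ.+-monoˡ-< (ℚ.- (ε ℚ.* r)) (ℚₚ.<-trans qQ<c+1 c+1<c+εQ) ⟩
  (s ℚ.+ ε ℚ.* r) ℚ.- ε ℚ.* r ≡⟨ ℚₚ.+-assoc s (ε ℚ.* r) (ℚ.- (ε ℚ.* r)) ⟩
  s ℚ.+ (ε ℚ.* r ℚ.- ε ℚ.* r) ≡⟨ cong (s ℚ.+_) (ℚₚ.+-inverseʳ (ε ℚ.* r)) ⟩
  s ℚ.+ 0ℚ                    ≡⟨ ℚₚ.+-identityʳ s ⟩
  s                           ∎
  where
  open ℚₚ.≤-Reasoning

  r s q : ℚ
  r = ℕ→ℚ Q
  s = ℕ→ℚ c
  q = (ℤ.+ 87) ℚ./ 62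

  62q≡87 : ℕ→ℚ 62 ℚ.* q ≡ ℕ→ℚ 87
  62q≡87 = refl

  c+1<c+εQ : ℕ→ℚ (c + 1) ℚ.< s ℚ.+ ε ℚ.* r
  c+1<c+εQ = subst (ℚ._< s ℚ.+ ε ℚ.* r) (sym (ℕ→ℚ-+ c 1)) (ℚₚ.+-monoʳ-< s (archimedean ε 0<ε Q d<Q))

  qQ<c+1 : q ℚ.* r ℚ.< ℕ→ℚ (c + 1)
  qQ<c+1 = ℚₚ.*-cancelˡ-<-nonNeg (ℕ→ℚ 62) (begin-strict
    ℕ→ℚ 62 ℚ.* (q ℚ.* r)    ≡⟨ ℚₚ.*-assoc (ℕ→ℚ 62) q r ⟨
    (ℕ→ℚ 62 ℚ.* q) ℚ.* r    ≡⟨ cong (ℚ._* r) 62q≡87 ⟩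
    ℕ→ℚ 87 ℚ.* r            ≡⟨ ℕ→ℚ-* 87 Q ⟨
    ℕ→ℚ (87 * Q)            <⟨ ℕ→ℚ-mono-< (≤-<-trans 87Q≤62c+12 (+-monoʳ-< (62 * c) (<ᵇ⇒< 12 62 _))) ⟩
    ℕ→ℚ (62 * c + 62)       ≡⟨ cong ℕ→ℚ (*-distribˡ-+ 62 c 1) ⟨
    ℕ→ℚ (62 * (c + 1))      ≡⟨ ℕ→ℚ-* 62 (c + 1) ⟩
    ℕ→ℚ 62 ℚ.* ℕ→ℚ (c + 1)  ∎)

theorem2 : (A : OnlineAlg) → Legal A →
    (ε : ℚ) → 0ℚ ℚ.< ε → (Q₀ : ℕ) →
    Σ ℕ λ Q → (Q ≥ Q₀) × Σ (List ℚ) λ I →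
    ValidInput I × IsOPT I Q ×
    (((ℤ.+ 87) ℚ./ 62 ℚ.- ε) ℚ.* ℕ→ℚ Q ℚ.< ℕ→ℚ (cost A Q I))
theorem2 A legal ε 0<ε Q₀ = conclude (Game.forced A legal h (s≤s z≤n) (2 ^ (4 * h)) ≤-refl)
  where
  -- Large enough that `4 * h` is at least `Q₀` and exceeds the denominator of `ε`.
  h : ℕ
  h = suc (Q₀ + ↧ₙ ε)

  h≤Q : h ≤ 4 * h
  h≤Q = m≤m+n h (3 * h)

  conclude : (Σ ℕ λ c → (Σ (List ℚ) λ I → ValidInput I × IsOPT I (4 * h) × c ≤ cost A (4 * h) I) ×
                        87 * (4 * h) ≤ 62 * c + 12) →
    Σ ℕ λ Q → (Q ≥ Q₀) × Σ (List ℚ) λ I → ValidInput I × IsOPT I Q ×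
      (((ℤ.+ 87) ℚ./ 62 ℚ.- ε) ℚ.* ℕ→ℚ Q ℚ.< ℕ→ℚ (cost A Q I))
  conclude (c , (I , valid , opt , c≤cost) , 87Q≤62c+12) =
    4 * h , ≤-trans (≤-trans (m≤m+n Q₀ (↧ₙ ε)) (n≤1+n _)) h≤Q , I , valid , opt ,
    ℚₚ.<-≤-trans (below-ratio ε 0<ε (4 * h) c (≤-trans (s≤s (m≤n+m (↧ₙ ε) Q₀)) h≤Q) 87Q≤62c+12)
                 (ℕ→ℚ-mono-≤ c≤cost)
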